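{- Let $n,k,m$ be positive integers with $1\leq k\leq n-2$ and $1\leq m\leq n-k-1$. Then $$q(\overrightarrow{K}(n,k,m))=\frac{3n-m-4+\sqrt{(n-3m)^2+8mk}}{2}.$$
   Context: $q(D)$ is the spectral radius of the signless Laplacian matrix $Q(D)=\mathrm{diag}(d_1^+,\ldots,d_n^+)+A(D)$ of a digraph $D$, where $d_i^+$ is the outdegree of vertex $i$ and $A(D)$ is the adjacency matrix. $\overrightarrow{K}(n,k,m)$ is the digraph whose vertex set is the disjoint union of sets $S$, $V_1$, $V_2$ with $|S|=k$, $|V_1|=m$, $|V_2|=n-m-k$, and whose arcs are all ordered pairs $(u,v)$ of distinct vertices except those with $u\in V_2$ and $v\in V_1$. -}

module Defs where

open import Algebra.Bundles.Raw using (RawMonoid)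
import Algebra.Definitions.RawMonoid as RawMonoidDefs
open import Data.Bool using (if_then_else_)
import Data.Fin as Fin
open import Data.Fin using (Fin)
open import Data.Fin.Subset using (Subset) renaming (∣_∣ to card)
open import Data.Integer as ℤ using (ℤ; +_; -[1+_]; +≤+)
import Data.Integer.Properties as ℤ
open import Data.Nat as ℕ using (ℕ; zero; suc; z≤n; s≤s)
import Data.Nat.Properties as ℕ
open import Data.Product using (Σ-syntax; ∃-syntax; _×_; _,_; proj₁; proj₂)
open import Data.Rational as ℚ using (ℚ; 0ℚ; 1ℚ; ½; ∣_∣; ↥_; ↧_; *≤*; mkℚ)
open import Data.Rational.Literals using () renaming (fromℤ to ℤ→ℚ)
import Data.Rational.Properties as ℚ
open import Data.Rational.Solver using (module +-*-Solver)
import Data.Rational.Unnormalised as ℚᵘ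
import Data.Rational.Unnormalised.Properties as ℚᵘ
open import Data.Sum using (inj₁; inj₂)
open import Data.Vec using (tabulate)
open import Data.Vec.Functional using (Vector)
open import Level using (0ℓ)
open import Relation.Binary using (Rel; Decidable; Irreflexive)
open import Relation.Binary.PropositionalEquality
  using (_≡_; _≢_; refl; sym; trans; cong; cong₂; subst; subst₂; ≢-sym; module ≡-Reasoning)
open import Relation.Nullary using (¬_; Dec; yes; no; does; contradiction)
open import Relation.Nullary.Decidable using (¬?; _×-dec_)

private
  ½-pos : ∀ {ε} → 0ℚ ℚ.< ε → 0ℚ ℚ.< ½ ℚ.* ε
  ½-pos {ε} 0<ε = subst (ℚ._< ½ ℚ.* ε) (ℚ.*-zeroʳ ½) (ℚ.*-monoʳ-<-pos ½ 0<ε)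

  ½+½ : ∀ ε → ½ ℚ.* ε ℚ.+ ½ ℚ.* ε ≡ ε
  ½+½ ε = trans (sym (ℚ.*-distribʳ-+ ε ½ ½)) (ℚ.*-identityˡ ε)

  *-pos : ∀ {p q} → 0ℚ ℚ.< p → 0ℚ ℚ.< q → 0ℚ ℚ.< p ℚ.* q
  *-pos {p} {q} 0<p 0<q =
    ℚ.positive⁻¹ (p ℚ.* q)
      {{ℚ.pos*pos⇒pos p {{ℚ.positive 0<p}} q {{ℚ.positive 0<q}}}}

  *-mono-≤ : ∀ {p q r s} → 0ℚ ℚ.≤ q → 0ℚ ℚ.≤ r → p ℚ.≤ q → r ℚ.≤ s →
             p ℚ.* r ℚ.≤ q ℚ.* s
  *-mono-≤ {p} {q} {r} {s} 0≤q 0≤r p≤q r≤s = ℚ.≤-trans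
    (ℚ.*-monoʳ-≤-nonNeg r {{ℚ.nonNegative 0≤r}} p≤q)
    (ℚ.*-monoˡ-≤-nonNeg q {{ℚ.nonNegative 0≤q}} r≤s)

  +-nonNeg : ∀ {p q} → 0ℚ ℚ.≤ p → 0ℚ ℚ.≤ q → 0ℚ ℚ.≤ p ℚ.+ q
  +-nonNeg 0≤p 0≤q = ℚ.+-mono-≤ 0≤p 0≤q

  p≤p+q : ∀ p {q} → 0ℚ ℚ.≤ q → p ℚ.≤ p ℚ.+ q
  p≤p+q p {q} 0≤q = subst (ℚ._≤ p ℚ.+ q) (ℚ.+-identityʳ p) (ℚ.+-monoʳ-≤ p 0≤q)

  ≤-from-∣-∣ : ∀ p q {ε} → ∣ p ℚ.- q ∣ ℚ.≤ ε → p ℚ.≤ q ℚ.+ ε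
  ≤-from-∣-∣ p q {ε} h = subst (ℚ._≤ q ℚ.+ ε) eq
    (ℚ.+-monoʳ-≤ q (ℚ.≤-trans (p≤∣p∣ (p ℚ.- q)) h))
    where
    open +-*-Solver
    eq : q ℚ.+ (p ℚ.- q) ≡ p
    eq = solve 2 (λ p q → q :+ (p :- q) := p) refl p q
    p≤∣p∣ : ∀ r → r ℚ.≤ ∣ r ∣
    p≤∣p∣ r with ℚ.≤-total 0ℚ r
    ... | inj₁ 0≤r = ℚ.≤-reflexive (sym (ℚ.0≤p⇒∣p∣≡p 0≤r))
    ... | inj₂ r≤0 = ℚ.≤-trans r≤0 (ℚ.0≤∣p∣ r)

  ∣-∣-from-≤ : ∀ p q {ε} → p ℚ.≤ q ℚ.+ ε → q ℚ.≤ p ℚ.+ ε → ∣ p ℚ.- q ∣ ℚ.≤ ε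
  ∣-∣-from-≤ p q {ε} h₁ h₂ with ℚ.∣p∣≡p∨∣p∣≡-p (p ℚ.- q)
  ... | inj₁ e = subst₂ ℚ._≤_ (sym e) eq (ℚ.+-monoˡ-≤ (ℚ.- q) h₁)
    where
    open +-*-Solver
    eq : (q ℚ.+ ε) ℚ.- q ≡ ε
    eq = solve 2 (λ q ε → (q :+ ε) :- q := ε) refl q ε
  ... | inj₂ e = subst₂ ℚ._≤_ (trans eq₁ (sym e)) eq₂ (ℚ.+-monoˡ-≤ (ℚ.- p) h₂)
    where
    open +-*-Solver
    eq₁ : q ℚ.- p ≡ ℚ.- (p ℚ.- q)
    eq₁ = solve 2 (λ p q → q :- p := :- (p :- q)) refl p q
    eq₂ : (p ℚ.+ ε) ℚ.- p ≡ ε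
    eq₂ = solve 2 (λ p ε → (p :+ ε) :- p := ε) refl p ε

IsCauchy : (ℕ → ℚ) → Set
IsCauchy x = ∀ ε → 0ℚ ℚ.< ε →
  ∃[ N ] ∀ i j → N ℕ.≤ i → N ℕ.≤ j → ∣ x i ℚ.- x j ∣ ℚ.≤ ε

record ℝ : Set where
  constructor mkℝ
  field
    seq    : ℕ → ℚ
    cauchy : IsCauchy seq

open ℝ public

infix  4 _≃_ _≤_
infixl 6 _+_ _-_
infixl 7 _*_
infix  8 -_

_≃_ : ℝ → ℝ → Set
x ≃ y = ∀ ε → 0ℚ ℚ.< ε → ∃[ N ] ∀ i → N ℕ.≤ i → ∣ seq x i ℚ.- seq y i ∣ ℚ.≤ ε

_≤_ : ℝ → ℝ → Set
x ≤ y = ∀ ε → 0ℚ ℚ.< ε → ∃[ N ] ∀ i → N ℕ.≤ i → seq x i ℚ.≤ seq y i ℚ.+ ε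

fromℚ : ℚ → ℝ
fromℚ q = mkℝ (λ _ → q) λ ε 0<ε → 0 , λ _ _ _ _ →
  subst (ℚ._≤ ε) (sym (cong ∣_∣ (ℚ.+-inverseʳ q))) (ℚ.<⇒≤ 0<ε)

fromℤ : ℤ → ℝ
fromℤ z = fromℚ (ℤ→ℚ z)

0ℝ : ℝ
0ℝ = fromℤ (+ 0)

_+_ : ℝ → ℝ → ℝ
x + y = mkℝ (λ i → seq x i ℚ.+ seq y i) λ ε 0<ε →
  let
    (M , hx) = cauchy x (½ ℚ.* ε) (½-pos 0<ε)
    (N , hy) = cauchy y (½ ℚ.* ε) (½-pos 0<ε)
  in M ℕ.⊔ N , λ i j le le′ → begin
    ∣ (seq x i ℚ.+ seq y i) ℚ.- (seq x j ℚ.+ seq y j) ∣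
      ≡⟨ cong ∣_∣ (eq (seq x i) (seq y i) (seq x j) (seq y j)) ⟩
    ∣ (seq x i ℚ.- seq x j) ℚ.+ (seq y i ℚ.- seq y j) ∣
      ≤⟨ ℚ.∣p+q∣≤∣p∣+∣q∣ (seq x i ℚ.- seq x j) (seq y i ℚ.- seq y j) ⟩
    ∣ seq x i ℚ.- seq x j ∣ ℚ.+ ∣ seq y i ℚ.- seq y j ∣
      ≤⟨ ℚ.+-mono-≤
           (hx i j (ℕ.m⊔n≤o⇒m≤o M N le) (ℕ.m⊔n≤o⇒m≤o M N le′))
           (hy i j (ℕ.m⊔n≤o⇒n≤o M N le) (ℕ.m⊔n≤o⇒n≤o M N le′)) ⟩
    ½ ℚ.* ε ℚ.+ ½ ℚ.* ε
      ≡⟨ ½+½ ε ⟩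
    ε ∎
  where
  open ℚ.≤-Reasoning
  eq : ∀ a b c d → (a ℚ.+ b) ℚ.- (c ℚ.+ d) ≡ (a ℚ.- c) ℚ.+ (b ℚ.- d)
  eq = solve 4 (λ a b c d → (a :+ b) :- (c :+ d) := (a :- c) :+ (b :- d)) refl
    where open +-*-Solver

-_ : ℝ → ℝ
- x = mkℝ (λ i → ℚ.- seq x i) λ ε 0<ε →
  let (N , hx) = cauchy x ε 0<ε
  in N , λ i j le le′ → subst (ℚ._≤ ε)
    (trans (sym (ℚ.∣-p∣≡∣p∣ (seq x i ℚ.- seq x j)))
           (cong ∣_∣ (ℚ.neg-distrib-+ (seq x i) (ℚ.- seq x j))))
    (hx i j le le′)

_-_ : ℝ → ℝ → ℝ
x - y = x + (- y)

eventuallyBounded : ∀ x → ∃[ B ] 0ℚ ℚ.< B × ∃[ N ] ∀ i → N ℕ.≤ i → ∣ seq x i ∣ ℚ.≤ B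
eventuallyBounded x =
  let (N , h) = cauchy x 1ℚ (ℚ.positive⁻¹ 1ℚ)
      c       = seq x N
  in ∣ c ∣ ℚ.+ 1ℚ , ℚ.+-mono-≤-< (ℚ.0≤∣p∣ c) (ℚ.positive⁻¹ 1ℚ) , N , λ i le → begin
    ∣ seq x i ∣                     ≡⟨ cong ∣_∣ (eq (seq x i) c) ⟩
    ∣ c ℚ.+ (seq x i ℚ.- c) ∣       ≤⟨ ℚ.∣p+q∣≤∣p∣+∣q∣ c (seq x i ℚ.- c) ⟩
    ∣ c ∣ ℚ.+ ∣ seq x i ℚ.- c ∣     ≤⟨ ℚ.+-monoʳ-≤ ∣ c ∣ (h i N le ℕ.≤-refl) ⟩
    ∣ c ∣ ℚ.+ 1ℚ                    ∎
  where
  open ℚ.≤-Reasoning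
  eq : ∀ a c → a ≡ c ℚ.+ (a ℚ.- c)
  eq = solve 2 (λ a c → a := c :+ (a :- c)) refl
    where open +-*-Solver

_*_ : ℝ → ℝ → ℝ
x * y = mkℝ (λ i → seq x i ℚ.* seq y i) λ ε 0<ε →
  let
    (B , 0<B , K , bx) = eventuallyBounded x
    (C , 0<C , L , by) = eventuallyBounded y
    S    = C ℚ.+ B
    0<S  = ℚ.+-mono-< 0<C 0<B
    S≢0  = ℚ.≢-nonZero (≢-sym (ℚ.<⇒≢ 0<S))
    S⁻¹  = ℚ.1/_ S {{S≢0}}
    η    = ε ℚ.* S⁻¹
    0<η  = *-pos 0<ε (ℚ.positive⁻¹ S⁻¹ {{ℚ.1/pos⇒pos S {{ℚ.positive 0<S}}}})
    (M , hx) = cauchy x η 0<η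
    (N , hy) = cauchy y η 0<η
    P    = (K ℕ.⊔ L) ℕ.⊔ (M ℕ.⊔ N)
    K≤P  = ℕ.≤-trans (ℕ.m≤m⊔n K L) (ℕ.m≤m⊔n (K ℕ.⊔ L) (M ℕ.⊔ N))
    L≤P  = ℕ.≤-trans (ℕ.m≤n⊔m K L) (ℕ.m≤m⊔n (K ℕ.⊔ L) (M ℕ.⊔ N))
    M≤P  = ℕ.≤-trans (ℕ.m≤m⊔n M N) (ℕ.m≤n⊔m (K ℕ.⊔ L) (M ℕ.⊔ N))
    N≤P  = ℕ.≤-trans (ℕ.m≤n⊔m M N) (ℕ.m≤n⊔m (K ℕ.⊔ L) (M ℕ.⊔ N))
  in P , λ i j le le′ →
    let a = seq x i ; b = seq y i ; c = seq x j ; d = seq y j in begin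
    ∣ a ℚ.* b ℚ.- c ℚ.* d ∣
      ≡⟨ cong ∣_∣ (eq a b c d) ⟩
    ∣ b ℚ.* (a ℚ.- c) ℚ.+ c ℚ.* (b ℚ.- d) ∣
      ≤⟨ ℚ.∣p+q∣≤∣p∣+∣q∣ (b ℚ.* (a ℚ.- c)) (c ℚ.* (b ℚ.- d)) ⟩
    ∣ b ℚ.* (a ℚ.- c) ∣ ℚ.+ ∣ c ℚ.* (b ℚ.- d) ∣
      ≡⟨ cong₂ ℚ._+_ (ℚ.∣p*q∣≡∣p∣*∣q∣ b (a ℚ.- c)) (ℚ.∣p*q∣≡∣p∣*∣q∣ c (b ℚ.- d)) ⟩
    ∣ b ∣ ℚ.* ∣ a ℚ.- c ∣ ℚ.+ ∣ c ∣ ℚ.* ∣ b ℚ.- d ∣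
      ≤⟨ ℚ.+-mono-≤
           (*-mono-≤ (ℚ.<⇒≤ 0<C) (ℚ.0≤∣p∣ (a ℚ.- c)) (by i (ℕ.≤-trans L≤P le))
             (hx i j (ℕ.≤-trans M≤P le) (ℕ.≤-trans M≤P le′)))
           (*-mono-≤ (ℚ.<⇒≤ 0<B) (ℚ.0≤∣p∣ (b ℚ.- d)) (bx j (ℕ.≤-trans K≤P le′))
             (hy i j (ℕ.≤-trans N≤P le) (ℕ.≤-trans N≤P le′))) ⟩
    C ℚ.* η ℚ.+ B ℚ.* η
      ≡⟨ eq′ C B ε S⁻¹ ⟩
    (S ℚ.* S⁻¹) ℚ.* ε
      ≡⟨ cong (ℚ._* ε) (ℚ.*-inverseʳ S {{S≢0}}) ⟩
    1ℚ ℚ.* ε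
      ≡⟨ ℚ.*-identityˡ ε ⟩
    ε ∎
  where
  open ℚ.≤-Reasoning
  open +-*-Solver
  eq : ∀ a b c d →
       a ℚ.* b ℚ.- c ℚ.* d ≡ b ℚ.* (a ℚ.- c) ℚ.+ c ℚ.* (b ℚ.- d)
  eq = solve 4 (λ a b c d → a :* b :- c :* d := b :* (a :- c) :+ c :* (b :- d)) refl
  eq′ : ∀ c b ε s → c ℚ.* (ε ℚ.* s) ℚ.+ b ℚ.* (ε ℚ.* s) ≡ ((c ℚ.+ b) ℚ.* s) ℚ.* ε
  eq′ = solve 4 (λ c b ε s →
    c :* (ε :* s) :+ b :* (ε :* s) := ((c :+ b) :* s) :* ε) refl

open RawMonoidDefs ℚ.+-0-rawMonoid using () renaming (_×_ to _×ℚ_)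

δ : ℕ → ℚ
δ n = ℚ.1/ ℤ→ℚ (+ suc n)

-- The largest r among 0, d, …, J d with r² ≤ q, and 0 if there is none.
largest : ℚ → ℚ → ℕ → ℚ
largest q d zero    = 0ℚ
largest q d (suc J) with (suc J ×ℚ d) ℚ.* (suc J ×ℚ d) ℚ.≤? q
... | yes _ = suc J ×ℚ d
... | no  _ = largest q d J

-- For q ≥ 0, the largest multiple of 1 / (n + 1) that is at most √q; the
-- search may start from |↥ q| + 1 because that exceeds √q.
approx√ : ℚ → ℕ → ℚ
approx√ q n = largest q (δ n) (suc ℤ.∣ ↥ q ∣ ℕ.* suc n)

private

  ℤ→ℚ-suc : ∀ k → ℤ→ℚ (+ suc k) ≡ 1ℚ ℚ.+ ℤ→ℚ (+ k)
  ℤ→ℚ-suc k = ℚ.toℚᵘ-injective (ℚᵘ.≃-trans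
    (ℚᵘ.*≡* (cong (λ z → (+ 1 ℤ.+ z) ℤ.* + 1) (sym (ℤ.*-identityʳ (+ k)))))
    (ℚᵘ.≃-sym (ℚ.toℚᵘ-homo-+ 1ℚ (ℤ→ℚ (+ k)))))

  ×ℚ≡* : ∀ k x → k ×ℚ x ≡ ℤ→ℚ (+ k) ℚ.* x
  ×ℚ≡* zero    x = sym (ℚ.*-zeroˡ x)
  ×ℚ≡* (suc k) x = begin
    x ℚ.+ k ×ℚ x                       ≡⟨ cong₂ ℚ._+_ (sym (ℚ.*-identityˡ x)) (×ℚ≡* k x) ⟩
    1ℚ ℚ.* x ℚ.+ ℤ→ℚ (+ k) ℚ.* x       ≡⟨ ℚ.*-distribʳ-+ x 1ℚ (ℤ→ℚ (+ k)) ⟨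
    (1ℚ ℚ.+ ℤ→ℚ (+ k)) ℚ.* x           ≡⟨ cong (ℚ._* x) (ℤ→ℚ-suc k) ⟨
    ℤ→ℚ (+ suc k) ℚ.* x                ∎
    where open ≡-Reasoning

  suc×δ : ∀ n → suc n ×ℚ δ n ≡ 1ℚ
  suc×δ n = trans (×ℚ≡* (suc n) (δ n)) (ℚ.*-inverseʳ (ℤ→ℚ (+ suc n)))

  0<δ : ∀ n → 0ℚ ℚ.< δ n
  0<δ n = ℚ.positive⁻¹ (δ n)

  ×ℚ-nonNeg : ∀ k {x} → 0ℚ ℚ.≤ x → 0ℚ ℚ.≤ k ×ℚ x
  ×ℚ-nonNeg zero    0≤x = ℚ.≤-refl
  ×ℚ-nonNeg (suc k) 0≤x = +-nonNeg 0≤x (×ℚ-nonNeg k 0≤x)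

  square-mono : ∀ {p q} → 0ℚ ℚ.≤ p → p ℚ.≤ q → p ℚ.* p ℚ.≤ q ℚ.* q
  square-mono 0≤p p≤q = *-mono-≤ (ℚ.≤-trans 0≤p p≤q) 0≤p p≤q p≤q

  q≤∣↥q∣ : ∀ q → q ℚ.≤ ℤ→ℚ (+ ℤ.∣ ↥ q ∣)
  q≤∣↥q∣ (mkℚ (+ a) d _) = *≤* (subst₂ ℤ._≤_
    (ℤ.pos-* a 1) (ℤ.pos-* a (suc d)) (+≤+ (ℕ.*-monoʳ-≤ a (s≤s z≤n))))
  q≤∣↥q∣ (mkℚ -[1+ a ] d _) = *≤* (subst₂ ℤ._≤_
    refl (ℤ.pos-* (suc a) (suc d)) ℤ.-≤+)

  largest-nonNeg : ∀ q {d} → 0ℚ ℚ.≤ d → ∀ J → 0ℚ ℚ.≤ largest q d J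
  largest-nonNeg q 0≤d zero = ℚ.≤-refl
  largest-nonNeg q {d} 0≤d (suc J) with (suc J ×ℚ d) ℚ.* (suc J ×ℚ d) ℚ.≤? q
  ... | yes _ = ×ℚ-nonNeg (suc J) 0≤d
  ... | no  _ = largest-nonNeg q 0≤d J

  largest-lower : ∀ q d J → 0ℚ ℚ.< largest q d J → largest q d J ℚ.* largest q d J ℚ.≤ q
  largest-lower q d zero 0<0 = contradiction 0<0 (ℚ.<-irrefl refl)
  largest-lower q d (suc J) 0<r with (suc J ×ℚ d) ℚ.* (suc J ×ℚ d) ℚ.≤? q
  ... | yes le = le
  ... | no  _  = largest-lower q d J 0<r

  largest-upper : ∀ q d J → q ℚ.< (suc J ×ℚ d) ℚ.* (suc J ×ℚ d) →
                  q ℚ.< (d ℚ.+ largest q d J) ℚ.* (d ℚ.+ largest q d J)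
  largest-upper q d zero    lt = lt
  largest-upper q d (suc J) lt with (suc J ×ℚ d) ℚ.* (suc J ×ℚ d) ℚ.≤? q
  ... | yes _ = lt
  ... | no ≰q = largest-upper q d J (ℚ.≰⇒> ≰q)

approx√-nonNeg : ∀ q n → 0ℚ ℚ.≤ approx√ q n
approx√-nonNeg q n = largest-nonNeg q (ℚ.<⇒≤ (0<δ n)) (suc ℤ.∣ ↥ q ∣ ℕ.* suc n)

approx√-lower : ∀ q n → 0ℚ ℚ.< approx√ q n → approx√ q n ℚ.* approx√ q n ℚ.≤ q
approx√-lower q n = largest-lower q (δ n) (suc ℤ.∣ ↥ q ∣ ℕ.* suc n)

approx√-upper : ∀ q n → q ℚ.< (δ n ℚ.+ approx√ q n) ℚ.* (δ n ℚ.+ approx√ q n)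
approx√-upper q n = largest-upper q (δ n) J (begin-strict
  q                      ≤⟨ q≤∣↥q∣ q ⟩
  A                      <⟨ subst (ℚ._< 1ℚ ℚ.+ A) (ℚ.+-identityˡ A)
                              (ℚ.+-monoˡ-< A (ℚ.positive⁻¹ 1ℚ)) ⟩
  P                      ≡⟨ ℚ.*-identityʳ P ⟨
  P ℚ.* 1ℚ               ≤⟨ *-mono-≤ 0≤P (ℚ.nonNegative⁻¹ 1ℚ) ℚ.≤-refl (p≤p+q 1ℚ 0≤A) ⟩
  P ℚ.* P                ≤⟨ square-mono 0≤P P≤ ⟩
  (suc J ×ℚ δ n) ℚ.* (suc J ×ℚ δ n) ∎)
  where
  open ℚ.≤-Reasoning
  open import Algebra.Properties.Monoid.Mult ℚ.+-0-monoid using (×-assocˡ)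
  a J : ℕ
  a = ℤ.∣ ↥ q ∣
  J = suc a ℕ.* suc n
  A P : ℚ
  A = ℤ→ℚ (+ a)
  P = 1ℚ ℚ.+ A
  0≤A : 0ℚ ℚ.≤ A
  0≤A = ℚ.nonNegative⁻¹ A
  0≤P : 0ℚ ℚ.≤ P
  0≤P = +-nonNeg (ℚ.nonNegative⁻¹ 1ℚ) 0≤A
  J×δ≡P : J ×ℚ δ n ≡ P
  J×δ≡P = begin-equality
    J ×ℚ δ n                     ≡⟨ ×-assocˡ (δ n) (suc a) (suc n) ⟨
    suc a ×ℚ (suc n ×ℚ δ n)      ≡⟨ cong (suc a ×ℚ_) (suc×δ n) ⟩
    suc a ×ℚ 1ℚ                  ≡⟨ ×ℚ≡* (suc a) 1ℚ ⟩
    ℤ→ℚ (+ suc a) ℚ.* 1ℚ         ≡⟨ ℚ.*-identityʳ (ℤ→ℚ (+ suc a)) ⟩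
    ℤ→ℚ (+ suc a)                ≡⟨ ℤ→ℚ-suc a ⟩
    P                            ∎
  P≤ : P ℚ.≤ suc J ×ℚ δ n
  P≤ = begin
    P                    ≤⟨ p≤p+q P (ℚ.<⇒≤ (0<δ n)) ⟩
    P ℚ.+ δ n            ≡⟨ ℚ.+-comm P (δ n) ⟩
    δ n ℚ.+ P            ≡⟨ cong (δ n ℚ.+_) J×δ≡P ⟨
    δ n ℚ.+ J ×ℚ δ n     ∎

private

  δ-antitone : ∀ {i j} → i ℕ.≤ j → δ j ℚ.≤ δ i
  δ-antitone i≤j = *≤* (ℤ.*-monoˡ-≤-nonNeg (+ 1) (+≤+ (s≤s i≤j)))

  δ-small : ∀ {ε} → 0ℚ ℚ.< ε → ∃[ N ] δ N ℚ.≤ ε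
  δ-small {mkℚ (+ zero)  d c} 0<ε with ℚ.positive 0<ε
  ... | ()
  δ-small {mkℚ (+ suc a) d c} 0<ε = d , *≤*
    (ℤ.*-monoʳ-≤-nonNeg (+ suc d) {+ 1} {+ suc a} (+≤+ (s≤s z≤n)))
  δ-small {mkℚ -[1+ a ]  d c} 0<ε with ℚ.positive 0<ε
  ... | ()

  approx√-close : ∀ p q i j ε → 0ℚ ℚ.< ε → δ j ℚ.≤ ½ ℚ.* ε →
                  p ℚ.≤ q ℚ.+ (½ ℚ.* ε) ℚ.* (½ ℚ.* ε) →
                  approx√ p i ℚ.≤ approx√ q j ℚ.+ ε
  approx√-close p q i j ε 0<ε δ≤ p≤ with approx√ p i ℚ.≤? approx√ q j ℚ.+ ε
  ... | yes le = le
  ... | no ≰   = contradiction p<p (ℚ.<-irrefl refl)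
    where
    open ℚ.≤-Reasoning
    r s t h : ℚ
    r = approx√ p i
    s = approx√ q j
    h = ½ ℚ.* ε
    t = δ j ℚ.+ s
    s+ε<r : s ℚ.+ ε ℚ.< r
    s+ε<r = ℚ.≰⇒> ≰
    0≤s : 0ℚ ℚ.≤ s
    0≤s = approx√-nonNeg q j
    0≤h : 0ℚ ℚ.≤ h
    0≤h = ℚ.<⇒≤ (½-pos 0<ε)
    0≤t : 0ℚ ℚ.≤ t
    0≤t = +-nonNeg (ℚ.<⇒≤ (0<δ j)) 0≤s
    t+h≤r : t ℚ.+ h ℚ.≤ r
    t+h≤r = begin
      (δ j ℚ.+ s) ℚ.+ h  ≤⟨ ℚ.+-monoˡ-≤ h (ℚ.+-monoˡ-≤ s δ≤) ⟩
      (h ℚ.+ s) ℚ.+ h    ≡⟨ solve 2 (λ h s → (h :+ s) :+ h := s :+ (h :+ h)) refl h s ⟩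
      s ℚ.+ (h ℚ.+ h)    ≡⟨ cong (s ℚ.+_) (½+½ ε) ⟩
      s ℚ.+ ε            ≤⟨ ℚ.<⇒≤ s+ε<r ⟩
      r                  ∎
      where open +-*-Solver
    0<r : 0ℚ ℚ.< r
    0<r = ℚ.≤-<-trans (+-nonNeg 0≤s (ℚ.<⇒≤ 0<ε)) s+ε<r
    p<p : p ℚ.< p
    p<p = begin-strict
      p                                      ≤⟨ p≤ ⟩
      q ℚ.+ h ℚ.* h                          <⟨ ℚ.+-monoˡ-< (h ℚ.* h) (approx√-upper q j) ⟩
      t ℚ.* t ℚ.+ h ℚ.* h                    ≤⟨ ℚ.+-monoʳ-≤ (t ℚ.* t) (p≤p+q (h ℚ.* h) (+-nonNeg 0≤th 0≤th)) ⟩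
      t ℚ.* t ℚ.+ (h ℚ.* h ℚ.+ (t ℚ.* h ℚ.+ t ℚ.* h))
        ≡⟨ solve 2 (λ t h → t :* t :+ (h :* h :+ (t :* h :+ t :* h)) := (t :+ h) :* (t :+ h)) refl t h ⟩
      (t ℚ.+ h) ℚ.* (t ℚ.+ h)                ≤⟨ square-mono (+-nonNeg 0≤t 0≤h) t+h≤r ⟩
      r ℚ.* r                                ≤⟨ approx√-lower p i 0<r ⟩
      p                                      ∎
      where
      open +-*-Solver
      0≤th : 0ℚ ℚ.≤ t ℚ.* h
      0≤th = subst (ℚ._≤ t ℚ.* h) (ℚ.*-zeroˡ 0ℚ) (*-mono-≤ 0≤t ℚ.≤-refl 0≤t 0≤h)

-- √ x is the square root of x for x ≥ 0, and 0 for x < 0.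
√ : ℝ → ℝ
√ x = mkℝ (λ i → approx√ (seq x i) i) λ ε 0<ε →
  let
    0<h      = ½-pos 0<ε
    (M , δM) = δ-small 0<h
    (N , hx) = cauchy x ((½ ℚ.* ε) ℚ.* (½ ℚ.* ε)) (*-pos 0<h 0<h)
    close : ∀ i j → M ℕ.⊔ N ℕ.≤ i → M ℕ.⊔ N ℕ.≤ j →
            approx√ (seq x i) i ℚ.≤ approx√ (seq x j) j ℚ.+ ε
    close i j le le′ = approx√-close (seq x i) (seq x j) i j ε 0<ε
      (ℚ.≤-trans (δ-antitone (ℕ.m⊔n≤o⇒m≤o M N le′)) δM)
      (≤-from-∣-∣ (seq x i) (seq x j)
        (hx i j (ℕ.m⊔n≤o⇒n≤o M N le) (ℕ.m⊔n≤o⇒n≤o M N le′)))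
  in M ℕ.⊔ N , λ i j le le′ →
    ∣-∣-from-≤ (approx√ (seq x i) i) (approx√ (seq x j) j)
      (close i j le le′) (close j i le′ le)

infix  4 _≃ᶜ_
infixl 6 _+ᶜ_
infixl 7 _*ᶜ_

record ℂ : Set where
  constructor _+i_
  field
    re im : ℝ

open ℂ public

_≃ᶜ_ : ℂ → ℂ → Set
z ≃ᶜ w = re z ≃ re w × im z ≃ im w

0ᶜ : ℂ
0ᶜ = 0ℝ +i 0ℝ

_+ᶜ_ _*ᶜ_ : ℂ → ℂ → ℂ
z +ᶜ w = (re z + re w) +i (im z + im w)
z *ᶜ w = (re z * re w - im z * im w) +i (re z * im w + im z * re w)

modulus : ℂ → ℝ
modulus z = √ (re z * re z + im z * im z)

+ᶜ-rawMonoid : RawMonoid 0ℓ 0ℓ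
+ᶜ-rawMonoid = record { Carrier = ℂ ; _≈_ = _≃ᶜ_ ; _∙_ = _+ᶜ_ ; ε = 0ᶜ }

open RawMonoidDefs +ᶜ-rawMonoid public using () renaming (sum to sumᶜ)

fromℕᶜ : ℕ → ℂ
fromℕᶜ k = fromℤ (+ k) +i 0ℝ

Matrix : Set → ℕ → Set
Matrix A n = Fin n → Fin n → A

IsEigenvalue : ∀ {n} → Matrix ℂ n → ℂ → Set
IsEigenvalue {n} M z = Σ[ v ∈ Vector ℂ n ]
  ¬ (∀ i → v i ≃ᶜ 0ᶜ) ×
  (∀ i → sumᶜ (λ j → M i j *ᶜ v j) ≃ᶜ z *ᶜ v i)

-- A relation rather than a function: it determines ρ up to ≃.
IsSpectralRadius : ∀ {n} → Matrix ℂ n → ℝ → Set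
IsSpectralRadius M ρ =
  (∃[ z ] IsEigenvalue M z × modulus z ≃ ρ) ×
  (∀ z → IsEigenvalue M z → modulus z ≤ ρ)

record Digraph (n : ℕ) : Set₁ where
  field
    Arc      : Rel (Fin n) 0ℓ
    arc?     : Decidable Arc
    loopless : Irreflexive _≡_ Arc

module _ {n} (D : Digraph n) where
  open Digraph D

  outNeighbours : Fin n → Subset n
  outNeighbours i = tabulate λ j → does (arc? i j)

  outdegree : Fin n → ℕ
  outdegree i = card (outNeighbours i)

  adjacency : Matrix ℕ n
  adjacency i j = if does (arc? i j) then 1 else 0

  outdegreeDiagonal : Matrix ℕ n
  outdegreeDiagonal i j = if does (i Fin.≟ j) then outdegree i else 0

  signlessLaplacian : Matrix ℂ n
  signlessLaplacian i j = fromℕᶜ (outdegreeDiagonal i j ℕ.+ adjacency i j)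

data Part : Set where
  S V₁ V₂ : Part

_≟ₚ_ : (p q : Part) → Dec (p ≡ q)
S  ≟ₚ S  = yes refl
S  ≟ₚ V₁ = no λ ()
S  ≟ₚ V₂ = no λ ()
V₁ ≟ₚ S  = no λ ()
V₁ ≟ₚ V₁ = yes refl
V₁ ≟ₚ V₂ = no λ ()
V₂ ≟ₚ S  = no λ ()
V₂ ≟ₚ V₁ = no λ ()
V₂ ≟ₚ V₂ = yes refl

-- The vertices numbered 0, …, k-1 form S, the next m form V₁ and the
-- remaining n-m-k form V₂.
part : ∀ {n} → ℕ → ℕ → Fin n → Part
part k m u =
  if does (Fin.toℕ u ℕ.<? k) then S else
  if does (Fin.toℕ u ℕ.<? k ℕ.+ m) then V₁ else V₂

K⃗ : (n k m : ℕ) → Digraph n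
K⃗ n k m = record
  { Arc      = λ u v → u ≢ v × ¬ (part k m u ≡ V₂ × part k m v ≡ V₁)
  ; arc?     = λ u v → ¬? (u Fin.≟ v) ×-dec
                       ¬? ((part k m u ≟ₚ V₂) ×-dec (part k m v ≟ₚ V₁))
  ; loopless = λ u≡v arc → proj₁ arc u≡v
  }

{-# OPTIONS --safe #-}

-- Write n = k + m + l. For an eigenvector v with eigenvalue z let t be the sum of
-- all v j and t′ the sum over j outside V₁. The rows of the matrix say that
-- (z - (n - 2)) v i = t for i outside V₂ and (z - (n - m - 2)) v i = t′ for i in V₂.
-- Summing these over the parts gives two linear equations in t and t′ whose
-- determinant is, up to the factors z - (n - 2) and z - (n - m - 2), the quadratic
-- (z - ρ) (z - ρ′) with ρ, ρ′ = (3n - m - 4 ± √d) / 2. Hence every eigenvalue is one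
-- of n - 2, n - m - 2, ρ, ρ′, all real and of modulus at most ρ; and ρ has an
-- eigenvector that is constant on S ∪ V₁ and on V₂. Since _≤_ is stable under double
-- negation, the case distinction over the four values is constructively harmless.
module Submission where

open import Defs
import Algebra.Solver.Ring as RingSolver
open import Algebra.Solver.Ring.AlmostCommutativeRing using (_-Raw-AlmostCommutative⟶_; fromCommutativeRing)
open import Algebra.Bundles using (CommutativeRing)
open import Algebra.Structures using (IsCommutativeRing)
import Algebra.Properties.Semiring.Sum as Sum
open import Data.Bool using (Bool; true; false; if_then_else_; _∧_)
import Data.Fin as Fin
open import Data.Fin using (Fin; zero; suc)
open import Data.Fin.Subset using () renaming (∣_∣ to card)
open import Data.Integer as ℤ using (ℤ; +_; +≤+)
import Data.Integer.Properties as ℤ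
import Data.Maybe as Maybe
open import Data.Nat as ℕ using (ℕ; zero; suc; _∸_; z≤n; s≤s)
import Data.Nat.Properties as ℕ
open import Data.Product using (∃-syntax; _×_; _,_; proj₁; proj₂)
open import Data.Rational as ℚ using (ℚ; 0ℚ; 1ℚ; ½; ∣_∣; *≤*; mkℚ)
open import Data.Rational.Literals using () renaming (fromℤ to ℤ→ℚ)
import Data.Rational.Properties as ℚ
import Data.Rational.Unnormalised as ℚᵘ
import Data.Rational.Unnormalised.Properties as ℚᵘ
import Data.Rational.Solver as ℚ-Solver
open import Data.Sum using (inj₁; inj₂; [_,_]′)
open import Function using (id)
open import Data.Vec using (tabulate)
open import Data.Vec.Functional using (Vector)
open import Level using (0ℓ)
open import Relation.Binary.PropositionalEquality
  using (_≡_; refl; sym; trans; cong; cong₂; subst; subst₂; ≢-sym; module ≡-Reasoning)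
open import Relation.Nullary using (¬_; does; yes; no; contradiction)
open import Relation.Nullary.Decidable using (dec⇒maybe)

-- Complex numbers are pairs of Cauchy sequences: equality with zero is undecidable, and "nonzero"
-- is a mere refutation, not a bound that would yield an inverse. So no complex number is inverted.
-- The rows are multiplied by both `z - (n - 2)` and `z - (n - m - 2)` before they are summed, and
-- the only principle beyond the ring laws is that a factor which is not zero cancels from a product
-- that is zero. The list of eigenvalues is therefore contrapositive: if `z` avoids the four values,
-- then `v` vanishes. What makes the matrix tractable is a loop added at every vertex: the entries
-- then depend on the parts alone. The loop is counted once in the outdegree and once in the
-- adjacency, and undoing both subtracts 2 on the diagonal, hence `n - 2` and `n - m - 2`. The
-- linear algebra is done over an arbitrary commutative ring with a homomorphism from ℚ, where ring
-- elements are atoms for the solver and rational constants such as `½` are coefficients.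

module ℚS = ℚ-Solver.+-*-Solver

-- Rational inequalities

-- Splits an inequality into the sign of a gap and an equation, which the ring solver can take over.
≤-by-gap : ∀ {p q} d → 0ℚ ℚ.≤ d → p ℚ.+ d ≡ q → p ℚ.≤ q
≤-by-gap {p} d 0≤d refl = subst (ℚ._≤ p ℚ.+ d) (ℚ.+-identityʳ p) (ℚ.+-monoʳ-≤ p 0≤d)

0≤q-p : ∀ {p q} → p ℚ.≤ q → 0ℚ ℚ.≤ q ℚ.- p
0≤q-p {p} {q} p≤q = subst (ℚ._≤ q ℚ.- p) (ℚ.+-inverseʳ p) (ℚ.+-monoˡ-≤ (ℚ.- p) p≤q)

0≤* : ∀ {p q} → 0ℚ ℚ.≤ p → 0ℚ ℚ.≤ q → 0ℚ ℚ.≤ p ℚ.* q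
0≤* {p} {q} 0≤p 0≤q = ℚ.nonNegative⁻¹ (p ℚ.* q)
  {{ℚ.nonNeg*nonNeg⇒nonNeg p {{ℚ.nonNegative 0≤p}} q {{ℚ.nonNegative 0≤q}}}}

0<* : ∀ {p q} → 0ℚ ℚ.< p → 0ℚ ℚ.< q → 0ℚ ℚ.< p ℚ.* q
0<* {p} {q} 0<p 0<q = ℚ.positive⁻¹ (p ℚ.* q)
  {{ℚ.pos*pos⇒pos p {{ℚ.positive 0<p}} q {{ℚ.positive 0<q}}}}

0≤+ : ∀ {p q} → 0ℚ ℚ.≤ p → 0ℚ ℚ.≤ q → 0ℚ ℚ.≤ p ℚ.+ q
0≤+ = ℚ.+-mono-≤

0<½* : ∀ {ε} → 0ℚ ℚ.< ε → 0ℚ ℚ.< ½ ℚ.* ε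
0<½* = 0<* (ℚ.positive⁻¹ ½)

½+½ : ∀ ε → ½ ℚ.* ε ℚ.+ ½ ℚ.* ε ≡ ε
½+½ = solve 1 (λ ε → con ½ :* ε :+ con ½ :* ε := ε) refl
  where open ℚS

½*< : ∀ {ε} → 0ℚ ℚ.< ε → ½ ℚ.* ε ℚ.< ε
½*< {ε} 0<ε = subst₂ ℚ._<_ (ℚ.+-identityʳ h) (½+½ ε) (ℚ.+-monoʳ-< h (0<½* 0<ε))
  where h = ½ ℚ.* ε

½*≤ : ∀ {ε} → 0ℚ ℚ.< ε → ½ ℚ.* ε ℚ.≤ ε
½*≤ 0<ε = ℚ.<⇒≤ (½*< 0<ε)

*-mono : ∀ {p q r s} → 0ℚ ℚ.≤ p → 0ℚ ℚ.≤ r → p ℚ.≤ q → r ℚ.≤ s → p ℚ.* r ℚ.≤ q ℚ.* s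
*-mono {p} {q} {r} {s} 0≤p 0≤r p≤q r≤s = ℚ.≤-trans
  (ℚ.*-monoʳ-≤-nonNeg r {{ℚ.nonNegative 0≤r}} p≤q)
  (ℚ.*-monoˡ-≤-nonNeg q {{ℚ.nonNegative (ℚ.≤-trans 0≤p p≤q)}} r≤s)

0≤square : ∀ p → 0ℚ ℚ.≤ p ℚ.* p
0≤square p with ℚ.∣p∣≡p∨∣p∣≡-p p
... | inj₁ e = 0≤* 0≤p 0≤p
  where 0≤p = subst (0ℚ ℚ.≤_) e (ℚ.0≤∣p∣ p)
... | inj₂ e = subst (0ℚ ℚ.≤_)
    (solve 1 (λ p → (:- p) :* (:- p) := p :* p) refl p) (0≤* 0≤-p 0≤-p)
  where
  open ℚS
  0≤-p = subst (0ℚ ℚ.≤_) e (ℚ.0≤∣p∣ p)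

square-<-square : ∀ {p q} → 0ℚ ℚ.≤ p → p ℚ.< q → p ℚ.* p ℚ.< q ℚ.* q
square-<-square {p} {q} 0≤p p<q = ℚ.≤-<-trans
  (ℚ.*-monoˡ-≤-nonNeg p {{ℚ.nonNegative 0≤p}} (ℚ.<⇒≤ p<q))
  (ℚ.*-monoˡ-<-pos q {{ℚ.positive (ℚ.≤-<-trans 0≤p p<q)}} p<q)

square-cancel-≤ : ∀ {p q} → 0ℚ ℚ.≤ q → p ℚ.* p ℚ.≤ q ℚ.* q → p ℚ.≤ q
square-cancel-≤ {p} {q} 0≤q p²≤q² with p ℚ.≤? q
... | yes p≤q = p≤q
... | no  p≰q = contradiction
  (ℚ.<-≤-trans (square-<-square 0≤q (ℚ.≰⇒> p≰q)) p²≤q²) (ℚ.<-irrefl refl)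

p≤∣p∣ : ∀ p → p ℚ.≤ ∣ p ∣
p≤∣p∣ p with ℚ.≤-total 0ℚ p
... | inj₁ 0≤p = ℚ.≤-reflexive (sym (ℚ.0≤p⇒∣p∣≡p 0≤p))
... | inj₂ p≤0 = ℚ.≤-trans p≤0 (ℚ.0≤∣p∣ p)

∣p-q∣≡∣q-p∣ : ∀ p q → ∣ p ℚ.- q ∣ ≡ ∣ q ℚ.- p ∣
∣p-q∣≡∣q-p∣ p q = trans (sym (ℚ.∣-p∣≡∣p∣ (p ℚ.- q)))
  (cong ∣_∣ (solve 2 (λ p q → :- (p :- q) := q :- p) refl p q))
  where open ℚS

∣p-r∣≤∣p-q∣+∣q-r∣ : ∀ p q r → ∣ p ℚ.- r ∣ ℚ.≤ ∣ p ℚ.- q ∣ ℚ.+ ∣ q ℚ.- r ∣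
∣p-r∣≤∣p-q∣+∣q-r∣ p q r = subst (λ d → ∣ d ∣ ℚ.≤ ∣ p ℚ.- q ∣ ℚ.+ ∣ q ℚ.- r ∣)
  (solve 3 (λ p q r → (p :- q) :+ (q :- r) := p :- r) refl p q r)
  (ℚ.∣p+q∣≤∣p∣+∣q∣ (p ℚ.- q) (q ℚ.- r))
  where open ℚS

p≤q+∣p-q∣ : ∀ p q → p ℚ.≤ q ℚ.+ ∣ p ℚ.- q ∣
p≤q+∣p-q∣ p q = subst (ℚ._≤ q ℚ.+ ∣ p ℚ.- q ∣)
  (solve 2 (λ p q → q :+ (p :- q) := p) refl p q)
  (ℚ.+-monoʳ-≤ q (p≤∣p∣ (p ℚ.- q)))
  where open ℚS

∣p∣≤∣q∣+∣p-q∣ : ∀ p q → ∣ p ∣ ℚ.≤ ∣ q ∣ ℚ.+ ∣ p ℚ.- q ∣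
∣p∣≤∣q∣+∣p-q∣ p q = subst (λ d → ∣ d ∣ ℚ.≤ ∣ q ∣ ℚ.+ ∣ p ℚ.- q ∣)
  (solve 2 (λ p q → q :+ (p :- q) := p) refl p q)
  (ℚ.∣p+q∣≤∣p∣+∣q∣ q (p ℚ.- q))
  where open ℚS

∣p-q∣≤ : ∀ p q {ε} → p ℚ.≤ q ℚ.+ ε → q ℚ.≤ p ℚ.+ ε → ∣ p ℚ.- q ∣ ℚ.≤ ε
∣p-q∣≤ p q {ε} p≤ q≤ with ℚ.∣p∣≡p∨∣p∣≡-p (p ℚ.- q)
... | inj₁ e = subst₂ ℚ._≤_ (sym e)
      (solve 2 (λ q ε → (q :+ ε) :- q := ε) refl q ε) (ℚ.+-monoˡ-≤ (ℚ.- q) p≤)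
  where open ℚS
... | inj₂ e = subst₂ ℚ._≤_
      (trans (solve 2 (λ p q → q :- p := :- (p :- q)) refl p q) (sym e))
      (solve 2 (λ p ε → (p :+ ε) :- p := ε) refl p ε) (ℚ.+-monoˡ-≤ (ℚ.- p) q≤)
  where open ℚS

-- Supplies the tolerance to demand of one factor when the other is bounded by `C`.
∃-quotient : ∀ {C ε} → 0ℚ ℚ.< C → 0ℚ ℚ.< ε → ∃[ η ] 0ℚ ℚ.< η × C ℚ.* η ≡ ε
∃-quotient {C} {ε} 0<C 0<ε = C⁻¹ ℚ.* ε , 0<* 0<C⁻¹ 0<ε , (
  trans (sym (ℚ.*-assoc C C⁻¹ ε))
    (trans (cong (ℚ._* ε) (ℚ.*-inverseʳ C {{C≢0}})) (ℚ.*-identityˡ ε)))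
  where
  C≢0 = ℚ.≢-nonZero (≢-sym (ℚ.<⇒≢ 0<C))
  C⁻¹ = ℚ.1/_ C {{C≢0}}
  0<C⁻¹ = ℚ.positive⁻¹ C⁻¹ {{ℚ.1/pos⇒pos C {{ℚ.positive 0<C}}}}

-- Equality of real numbers

-- A record around _≃_, from which Agda can infer the two reals compared.
infix 4 _≈_
record _≈_ (x y : ℝ) : Set where
  constructor mk≈
  field un≈ : x ≃ y
open _≈_

pointwise : ∀ {x y} → (∀ i → seq x i ≡ seq y i) → x ≈ y
pointwise {x} {y} x≡y = mk≈ λ ε 0<ε → 0 , λ i _ → subst (ℚ._≤ ε)
  (sym (cong ∣_∣ (trans (cong (ℚ._- seq y i) (x≡y i)) (ℚ.+-inverseʳ (seq y i)))))
  (ℚ.<⇒≤ 0<ε)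

≈-refl : ∀ {x} → x ≈ x
≈-refl = pointwise λ _ → refl

≈-sym : ∀ {x y} → x ≈ y → y ≈ x
≈-sym {x} {y} (mk≈ x≃y) = mk≈ λ ε 0<ε → let (N , h) = x≃y ε 0<ε in
  N , λ i le → subst (ℚ._≤ ε) (∣p-q∣≡∣q-p∣ (seq x i) (seq y i)) (h i le)

≈-trans : ∀ {x y z} → x ≈ y → y ≈ z → x ≈ z
≈-trans {x} {y} {z} (mk≈ x≃y) (mk≈ y≃z) = mk≈ λ ε 0<ε →
  let (M , f) = x≃y (½ ℚ.* ε) (0<½* 0<ε)
      (N , g) = y≃z (½ ℚ.* ε) (0<½* 0<ε)
  in M ℕ.⊔ N , λ i le → begin
    ∣ seq x i ℚ.- seq z i ∣
      ≤⟨ ∣p-r∣≤∣p-q∣+∣q-r∣ (seq x i) (seq y i) (seq z i) ⟩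
    ∣ seq x i ℚ.- seq y i ∣ ℚ.+ ∣ seq y i ℚ.- seq z i ∣
      ≤⟨ ℚ.+-mono-≤ (f i (ℕ.m⊔n≤o⇒m≤o M N le)) (g i (ℕ.m⊔n≤o⇒n≤o M N le)) ⟩
    ½ ℚ.* ε ℚ.+ ½ ℚ.* ε
      ≡⟨ ½+½ ε ⟩
    ε ∎
  where open ℚ.≤-Reasoning

+-congʳ : ∀ {x y} z → x ≈ y → x + z ≈ y + z
+-congʳ {x} {y} z (mk≈ x≃y) = mk≈ λ ε 0<ε → let (N , h) = x≃y ε 0<ε in
  N , λ i le → subst (λ d → ∣ d ∣ ℚ.≤ ε)
    (solve 3 (λ x y z → x :- y := (x :+ z) :- (y :+ z)) refl (seq x i) (seq y i) (seq z i))
    (h i le)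
  where open ℚS

+-comm : ∀ x y → x + y ≈ y + x
+-comm x y = pointwise λ i → ℚ.+-comm (seq x i) (seq y i)

+-cong : ∀ {x x′ y y′} → x ≈ x′ → y ≈ y′ → x + y ≈ x′ + y′
+-cong {x} {x′} {y} {y′} p q =
  ≈-trans {x + y} {x′ + y} {x′ + y′} (+-congʳ {x} {x′} y p)
    (≈-trans {x′ + y} {y + x′} {x′ + y′} (+-comm x′ y)
      (≈-trans {y + x′} {y′ + x′} {x′ + y′} (+-congʳ {y} {y′} x′ q) (+-comm y′ x′)))

-‿cong : ∀ {x y} → x ≈ y → - x ≈ - y
-‿cong {x} {y} (mk≈ x≃y) = mk≈ λ ε 0<ε → let (N , h) = x≃y ε 0<ε in
  N , λ i le → subst (ℚ._≤ ε)
    (trans (∣p-q∣≡∣q-p∣ (seq x i) (seq y i))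
      (cong ∣_∣ (solve 2 (λ x y → y :- x := (:- x) :- (:- y)) refl (seq x i) (seq y i))))
    (h i le)
  where open ℚS

*-congʳ : ∀ {x y} z → x ≈ y → x * z ≈ y * z
*-congʳ {x} {y} z (mk≈ x≃y) = mk≈ λ ε 0<ε →
  let (B , 0<B , M , bz) = eventuallyBounded z
      (η , 0<η , Bη≡ε)   = ∃-quotient 0<B 0<ε
      (N , h)            = x≃y η 0<η
  in M ℕ.⊔ N , λ i le → let a = seq x i ; b = seq y i ; c = seq z i in begin
    ∣ a ℚ.* c ℚ.- b ℚ.* c ∣
      ≡⟨ cong ∣_∣ (solve 3 (λ a b c → a :* c :- b :* c := c :* (a :- b)) refl a b c) ⟩
    ∣ c ℚ.* (a ℚ.- b) ∣
      ≡⟨ ℚ.∣p*q∣≡∣p∣*∣q∣ c (a ℚ.- b) ⟩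
    ∣ c ∣ ℚ.* ∣ a ℚ.- b ∣
      ≤⟨ *-mono (ℚ.0≤∣p∣ c) (ℚ.0≤∣p∣ (a ℚ.- b))
           (bz i (ℕ.m⊔n≤o⇒m≤o M N le)) (h i (ℕ.m⊔n≤o⇒n≤o M N le)) ⟩
    B ℚ.* η
      ≡⟨ Bη≡ε ⟩
    ε ∎
  where
  open ℚ.≤-Reasoning
  open ℚS using (solve; _:*_; _:-_; _:=_)

*-comm : ∀ x y → x * y ≈ y * x
*-comm x y = pointwise λ i → ℚ.*-comm (seq x i) (seq y i)

*-cong : ∀ {x x′ y y′} → x ≈ x′ → y ≈ y′ → x * y ≈ x′ * y′
*-cong {x} {x′} {y} {y′} p q =
  ≈-trans {x * y} {x′ * y} {x′ * y′} (*-congʳ {x} {x′} y p)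
    (≈-trans {x′ * y} {y * x′} {x′ * y′} (*-comm x′ y)
      (≈-trans {y * x′} {y′ * x′} {x′ * y′} (*-congʳ {y} {y′} x′ q) (*-comm y′ x′)))

-- Order and square roots of real numbers

p-0≡p : ∀ p → p ℚ.- ℤ→ℚ (+ 0) ≡ p
p-0≡p p = trans (cong (p ℚ.+_) {ℚ.- ℤ→ℚ (+ 0)} {0ℚ} refl) (ℚ.+-identityʳ p)

Null : ℝ → Set
Null x = ∀ ε → 0ℚ ℚ.< ε → ∃[ N ] ∀ i → N ℕ.≤ i → ∣ seq x i ∣ ℚ.≤ ε

≈0⇒Null : ∀ {x} → x ≈ 0ℝ → Null x
≈0⇒Null {x} (mk≈ x≃0) ε 0<ε = let (N , h) = x≃0 ε 0<ε in
  N , λ i le → subst (λ d → ∣ d ∣ ℚ.≤ ε) (p-0≡p (seq x i)) (h i le)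

Null⇒≈0 : ∀ {x} → Null x → x ≈ 0ℝ
Null⇒≈0 {x} null = mk≈ λ ε 0<ε → let (N , h) = null ε 0<ε in
  N , λ i le → subst (λ d → ∣ d ∣ ℚ.≤ ε) (sym (p-0≡p (seq x i))) (h i le)

∣z∣≤h+h : ∀ {q h} y z → q ℚ.≤ h → ∣ y ∣ ℚ.≤ h → ∣ z ℚ.- y ∣ ℚ.≤ q → ∣ z ∣ ℚ.≤ h ℚ.+ h
∣z∣≤h+h {q} {h} y z q≤h small close = begin
  ∣ z ∣                    ≤⟨ ∣p∣≤∣q∣+∣p-q∣ z y ⟩
  ∣ y ∣ ℚ.+ ∣ z ℚ.- y ∣    ≤⟨ ℚ.+-mono-≤ small (ℚ.≤-trans close q≤h) ⟩
  h ℚ.+ h                  ∎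
  where open ℚ.≤-Reasoning

-- This is how one large term of a Cauchy sequence keeps all later terms away from 0.
q≤∣z∣ : ∀ {q} y z → q ℚ.+ q ℚ.≤ ∣ y ∣ → ∣ y ℚ.- z ∣ ℚ.≤ q → q ℚ.≤ ∣ z ∣
q≤∣z∣ {q} y z large close =
  subst₂ ℚ._≤_ (p+q-q≡p q q) (p+q-q≡p ∣ z ∣ q) (ℚ.+-monoˡ-≤ (ℚ.- q) (begin
    q ℚ.+ q                  ≤⟨ large ⟩
    ∣ y ∣                    ≤⟨ ∣p∣≤∣q∣+∣p-q∣ y z ⟩
    ∣ z ∣ ℚ.+ ∣ y ℚ.- z ∣    ≤⟨ ℚ.+-monoʳ-≤ ∣ z ∣ close ⟩
    ∣ z ∣ ℚ.+ q              ∎))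
  where
  open ℚ.≤-Reasoning
  open ℚS using (solve; _:+_; _:-_; _:=_)
  p+q-q≡p : ∀ p q → (p ℚ.+ q) ℚ.- q ≡ p
  p+q-q≡p = solve 2 (λ p q → (p :+ q) :- q := p) refl

Null-cancel : ∀ {x y} q N → 0ℚ ℚ.< q → (∀ i → N ℕ.≤ i → q ℚ.≤ ∣ seq y i ∣) →
              Null (x * y) → Null x
Null-cancel {x} {y} q N 0<q q≤∣y∣ xy-null η 0<η =
  let (M , h) = xy-null (η ℚ.* q) (0<* 0<η 0<q) in
  M ℕ.⊔ N , λ i le → ℚ.*-cancelʳ-≤-pos q {{ℚ.positive 0<q}} (begin
    ∣ seq x i ∣ ℚ.* q
      ≤⟨ ℚ.*-monoˡ-≤-nonNeg ∣ seq x i ∣ {{ℚ.∣-∣-nonNeg (seq x i)}}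
           (q≤∣y∣ i (ℕ.m⊔n≤o⇒n≤o M N le)) ⟩
    ∣ seq x i ∣ ℚ.* ∣ seq y i ∣
      ≡⟨ ℚ.∣p*q∣≡∣p∣*∣q∣ (seq x i) (seq y i) ⟨
    ∣ seq x i ℚ.* seq y i ∣
      ≤⟨ h i (ℕ.m⊔n≤o⇒m≤o M N le) ⟩
    η ℚ.* q ∎)
  where open ℚ.≤-Reasoning

-- Constructively valid: comparing the N-th term of y with ε / 2 for a large N
-- shows that ∣ y ∣ ≤ ε or that y is bounded away from 0, when x = 0 follows.
*-cancelˡ-0 : ∀ {x y} → ¬ (x ≈ 0ℝ) → x * y ≈ 0ℝ → y ≈ 0ℝ
*-cancelˡ-0 {x} {y} x≉0 xy≈0 = Null⇒≈0 {y} null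
  where
  null : Null y
  null ε 0<ε = N , λ i le → subst (∣ seq y i ∣ ℚ.≤_) (½+½ ε)
      (∣z∣≤h+h (seq y N) (seq y i) (½*≤ 0<h) small (close i N le ℕ.≤-refl))
    where
    h = ½ ℚ.* ε
    q = ½ ℚ.* h
    0<h : 0ℚ ℚ.< h
    0<h = 0<½* 0<ε
    0<q : 0ℚ ℚ.< q
    0<q = 0<½* 0<h
    N     = proj₁ (cauchy y q 0<q)
    close = proj₂ (cauchy y q 0<q)
    x≈0 : h ℚ.≤ ∣ seq y N ∣ → x ≈ 0ℝ
    x≈0 large = Null⇒≈0 {x} (Null-cancel {x} {y} q N 0<q
      (λ i le → q≤∣z∣ (seq y N) (seq y i)
        (subst (ℚ._≤ ∣ seq y N ∣) (sym (½+½ h)) large) (close N i ℕ.≤-refl le))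
      (≈0⇒Null {x * y} xy≈0))
    small : ∣ seq y N ∣ ℚ.≤ h
    small = [ id , (λ large → contradiction (x≈0 large) x≉0) ]′ (ℚ.≤-total ∣ seq y N ∣ h)

∣p∣*∣p∣≡p*p : ∀ p → ∣ p ∣ ℚ.* ∣ p ∣ ≡ p ℚ.* p
∣p∣*∣p∣≡p*p p = trans (sym (ℚ.∣p*q∣≡∣p∣*∣q∣ p p)) (ℚ.0≤p⇒∣p∣≡p (0≤square p))

x²+y²≈0⇒x≈0 : ∀ x y → x * x + y * y ≈ 0ℝ → x ≈ 0ℝ
x²+y²≈0⇒x≈0 x y sum≈0 = Null⇒≈0 {x} λ ε 0<ε →
  let (N , h) = ≈0⇒Null {x * x + y * y} sum≈0 (ε ℚ.* ε) (0<* 0<ε 0<ε) in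
  N , λ i le → square-cancel-≤ (ℚ.<⇒≤ 0<ε) (let a = seq x i ; b = seq y i in begin
    ∣ a ∣ ℚ.* ∣ a ∣           ≡⟨ ∣p∣*∣p∣≡p*p a ⟩
    a ℚ.* a                   ≤⟨ ≤-by-gap (b ℚ.* b) (0≤square b) refl ⟩
    a ℚ.* a ℚ.+ b ℚ.* b       ≤⟨ p≤∣p∣ (a ℚ.* a ℚ.+ b ℚ.* b) ⟩
    ∣ a ℚ.* a ℚ.+ b ℚ.* b ∣   ≤⟨ h i le ⟩
    ε ℚ.* ε                   ∎)
  where open ℚ.≤-Reasoning

≤-pointwise : ∀ {x y} → (∀ i → seq x i ℚ.≤ seq y i) → x ≤ y
≤-pointwise {x} {y} x≤y ε 0<ε = 0 , λ i _ → ≤-by-gap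
  ((seq y i ℚ.- seq x i) ℚ.+ ε) (0≤+ (0≤q-p (x≤y i)) (ℚ.<⇒≤ 0<ε)) (gap (seq x i) (seq y i) ε)
  where
  open ℚS
  gap : ∀ p q ε → p ℚ.+ ((q ℚ.- p) ℚ.+ ε) ≡ q ℚ.+ ε
  gap = solve 3 (λ p q ε → p :+ ((q :- p) :+ ε) := q :+ ε) refl

≈⇒≤ : ∀ {x y} → x ≈ y → x ≤ y
≈⇒≤ {x} {y} (mk≈ x≃y) ε 0<ε = let (N , h) = x≃y ε 0<ε in
  N , λ i le → ℚ.≤-trans (p≤q+∣p-q∣ (seq x i) (seq y i)) (ℚ.+-monoʳ-≤ (seq y i) (h i le))

≤-trans : ∀ {x y z} → x ≤ y → y ≤ z → x ≤ z
≤-trans {x} {y} {z} x≤y y≤z ε 0<ε =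
  let (M , f) = x≤y (½ ℚ.* ε) (0<½* 0<ε)
      (N , g) = y≤z (½ ℚ.* ε) (0<½* 0<ε)
      h       = ½ ℚ.* ε
  in M ℕ.⊔ N , λ i le → begin
    seq x i                 ≤⟨ f i (ℕ.m⊔n≤o⇒m≤o M N le) ⟩
    seq y i ℚ.+ h           ≤⟨ ℚ.+-monoˡ-≤ h (g i (ℕ.m⊔n≤o⇒n≤o M N le)) ⟩
    (seq z i ℚ.+ h) ℚ.+ h   ≡⟨ ℚ.+-assoc (seq z i) h h ⟩
    seq z i ℚ.+ (h ℚ.+ h)   ≡⟨ cong (seq z i ℚ.+_) (½+½ ε) ⟩
    seq z i ℚ.+ ε           ∎
  where open ℚ.≤-Reasoning

≤-antisym : ∀ {x y} → x ≤ y → y ≤ x → x ≈ y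
≤-antisym {x} {y} x≤y y≤x = mk≈ λ ε 0<ε →
  let (M , f) = x≤y ε 0<ε
      (N , g) = y≤x ε 0<ε
  in M ℕ.⊔ N , λ i le → ∣p-q∣≤ (seq x i) (seq y i)
    (f i (ℕ.m⊔n≤o⇒m≤o M N le)) (g i (ℕ.m⊔n≤o⇒n≤o M N le))

-- From `N` on the difference `u` varies by at most `q`, a quarter of `ε`, so the comparison of the
-- single rational `u N` with `h` settles the matter: `u N ≤ h` bounds all later terms by `h + q`,
-- while `h ≤ u N` refutes `x ≤ y`.
≤-stable : ∀ {x y} → ¬ ¬ (x ≤ y) → x ≤ y
≤-stable {x} {y} ¬¬x≤y ε 0<ε = N , bound
  where
  open ℚ.≤-Reasoning
  h = ½ ℚ.* ε
  q = ½ ℚ.* h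
  0<h : 0ℚ ℚ.< h
  0<h = 0<½* 0<ε
  0<q : 0ℚ ℚ.< q
  0<q = 0<½* 0<h
  N     = proj₁ (cauchy (x - y) q 0<q)
  close = proj₂ (cauchy (x - y) q 0<q)
  u : ℕ → ℚ
  u i = seq x i ℚ.- seq y i
  u≤ : ∀ {i j} → N ℕ.≤ i → N ℕ.≤ j → u i ℚ.≤ u j ℚ.+ q
  u≤ {i} {j} le le′ = ℚ.≤-trans (p≤q+∣p-q∣ (u i) (u j)) (ℚ.+-monoʳ-≤ (u j) (close i j le le′))
  shift : ∀ p q → q ℚ.+ (p ℚ.- q) ≡ p
  shift = solve 2 (λ p q → q :+ (p :- q) := p) refl
    where open ℚS
  shift′ : ∀ p q → (q ℚ.+ p) ℚ.- q ≡ p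
  shift′ = solve 2 (λ p q → (q :+ p) :- q := p) refl
    where open ℚS
  x≰y : h ℚ.≤ u N → ¬ (x ≤ y)
  x≰y h≤uN x≤y = ℚ.<-irrefl refl (begin-strict
    h                 ≤⟨ h≤uN ⟩
    u N               ≤⟨ u≤ ℕ.≤-refl (ℕ.m≤n⊔m M N) ⟩
    u K ℚ.+ q         ≤⟨ ℚ.+-monoˡ-≤ q uK≤ ⟩
    ½ ℚ.* q ℚ.+ q     <⟨ ℚ.+-monoˡ-< q (½*< 0<q) ⟩
    q ℚ.+ q           ≡⟨ ½+½ h ⟩
    h                 ∎)
    where
    -- The tolerance is half of `q` so that the chain to `h` contains a strict step.
    M = proj₁ (x≤y (½ ℚ.* q) (0<½* 0<q))
    K = M ℕ.⊔ N
    uK≤ : u K ℚ.≤ ½ ℚ.* q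
    uK≤ = subst (u K ℚ.≤_) (shift′ (½ ℚ.* q) (seq y K))
      (ℚ.+-monoˡ-≤ (ℚ.- seq y K) (proj₂ (x≤y (½ ℚ.* q) (0<½* 0<q)) K (ℕ.m≤m⊔n M N)))
  uN≤h : u N ℚ.≤ h
  uN≤h = [ id , (λ h≤uN → contradiction (x≰y h≤uN) ¬¬x≤y) ]′ (ℚ.≤-total (u N) h)
  bound : ∀ i → N ℕ.≤ i → seq x i ℚ.≤ seq y i ℚ.+ ε
  bound i le = begin
    seq x i                   ≡⟨ shift (seq x i) (seq y i) ⟨
    seq y i ℚ.+ u i           ≤⟨ ℚ.+-monoʳ-≤ (seq y i) (u≤ le ℕ.≤-refl) ⟩
    seq y i ℚ.+ (u N ℚ.+ q)   ≤⟨ ℚ.+-monoʳ-≤ (seq y i) (ℚ.+-mono-≤ uN≤h (½*≤ 0<h)) ⟩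
    seq y i ℚ.+ (h ℚ.+ h)     ≡⟨ cong (seq y i ℚ.+_) (½+½ ε) ⟩
    seq y i ℚ.+ ε             ∎

-- A tolerance `ε²` on the squares becomes `ε` because `b² + ε² ≤ (b + ε)²` for `b ≥ 0`.
square-≤-square⇒≤ : ∀ {x y} → (∀ i → 0ℚ ℚ.≤ seq y i) → x * x ≤ y * y → x ≤ y
square-≤-square⇒≤ {x} {y} 0≤y x²≤y² ε 0<ε =
  let (N , h) = x²≤y² (ε ℚ.* ε) (0<* 0<ε 0<ε) in
  N , λ i le → let a = seq x i ; b = seq y i in
  square-cancel-≤ (0≤+ (0≤y i) 0≤ε) (begin
    a ℚ.* a                        ≤⟨ h i le ⟩
    b ℚ.* b ℚ.+ ε ℚ.* ε            ≤⟨ ≤-by-gap (b ℚ.* ε ℚ.+ b ℚ.* ε)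
                                        (0≤+ (0≤* (0≤y i) 0≤ε) (0≤* (0≤y i) 0≤ε)) (square-+ b ε) ⟩
    (b ℚ.+ ε) ℚ.* (b ℚ.+ ε)        ∎)
  where
  open ℚ.≤-Reasoning
  0≤ε = ℚ.<⇒≤ 0<ε
  square-+ : ∀ b ε → (b ℚ.* b ℚ.+ ε ℚ.* ε) ℚ.+ (b ℚ.* ε ℚ.+ b ℚ.* ε) ≡ (b ℚ.+ ε) ℚ.* (b ℚ.+ ε)
  square-+ = solve 2 (λ b ε →
    (b :* b :+ ε :* ε) :+ (b :* ε :+ b :* ε) := (b :+ ε) :* (b :+ ε)) refl
    where open ℚS

δ≤ε : ∀ {ε} → 0ℚ ℚ.< ε → ∃[ N ] ∀ i → N ℕ.≤ i → δ i ℚ.≤ ε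
δ≤ε {ε} 0<ε = N ε 0<ε , λ i le → ℚ.≤-trans (antitone le) (bound ε 0<ε)
  where
  antitone : ∀ {i j} → i ℕ.≤ j → δ j ℚ.≤ δ i
  antitone i≤j = *≤* (ℤ.*-monoˡ-≤-nonNeg (+ 1) (+≤+ (s≤s i≤j)))
  N : ∀ ε → 0ℚ ℚ.< ε → ℕ
  -- The stored `d-1` is the denominator less 1, so `δ d-1` is the unit fraction with the same
  -- denominator as `ε`.
  N (mkℚ _ d-1 _) _ = d-1
  bound : ∀ ε (0<ε : 0ℚ ℚ.< ε) → δ (N ε 0<ε) ℚ.≤ ε
  bound (mkℚ (+ suc a) d-1 _) _ = *≤*
    (ℤ.*-monoʳ-≤-nonNeg (+ suc d-1) {+ 1} {+ suc a} (+≤+ (s≤s z≤n)))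
  bound (mkℚ (+ zero) _ _) 0<ε with () ← ℚ.positive 0<ε
  bound (mkℚ ℤ.-[1+ _ ] _ _) 0<ε with () ← ℚ.positive 0<ε

approx√-square : ∀ {q} → 0ℚ ℚ.≤ q → ∀ n → approx√ q n ℚ.* approx√ q n ℚ.≤ q
approx√-square {q} 0≤q n with 0ℚ ℚ.<? approx√ q n
... | yes 0<r = approx√-lower q n 0<r
-- `approx√-lower` is silent about the default value 0, whose square is at most `q` only because
-- `0 ≤ q`.
... | no  0≮r = subst (λ r → r ℚ.* r ℚ.≤ q)
  (ℚ.≤-antisym (approx√-nonNeg q n) (ℚ.≮⇒≥ 0≮r)) 0≤q

√-square : ∀ x → (∀ i → 0ℚ ℚ.≤ seq x i) → √ x * √ x ≈ x
√-square x 0≤x = mk≈ λ ε 0<ε →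
  let (B , 0<B , M , bounded) = eventuallyBounded (√ x)
      -- An upper bound for `d + 2 r`, the cofactor of `d` in `(d + r)² - r²`, from `d ≤ 1` and
      -- `r ≤ B`.
      C                       = 1ℚ ℚ.+ (B ℚ.+ B)
      0<C                     = ℚ.+-mono-<-≤ (ℚ.positive⁻¹ 1ℚ) (ℚ.<⇒≤ (ℚ.+-mono-< 0<B 0<B))
      (η , 0<η , Cη≡ε)        = ∃-quotient 0<C 0<ε
      (N , δ≤η)               = δ≤ε 0<η
  in M ℕ.⊔ N , λ i le →
    let q   = seq x i
        r   = approx√ q i
        d   = δ i
        0≤d = ℚ.nonNegative⁻¹ d
        0≤r = approx√-nonNeg q i
        r≤B = ℚ.≤-trans (p≤∣p∣ r) (bounded i (ℕ.m⊔n≤o⇒m≤o M N le))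
    in ∣p-q∣≤ (r ℚ.* r) q
      (≤-by-gap ((q ℚ.- r ℚ.* r) ℚ.+ ε)
        (0≤+ (0≤q-p (approx√-square (0≤x i) i)) (ℚ.<⇒≤ 0<ε))
        (solve 3 (λ q s ε → s :+ ((q :- s) :+ ε) := q :+ ε) refl q (r ℚ.* r) ε))
      (begin
        q                                         ≤⟨ ℚ.<⇒≤ (approx√-upper q i) ⟩
        (d ℚ.+ r) ℚ.* (d ℚ.+ r)
          ≡⟨ solve 2 (λ d r → (d :+ r) :* (d :+ r) := r :* r :+ (d :+ (r :+ r)) :* d) refl d r ⟩
        r ℚ.* r ℚ.+ (d ℚ.+ (r ℚ.+ r)) ℚ.* d
          ≤⟨ ℚ.+-monoʳ-≤ (r ℚ.* r) (*-mono (0≤+ 0≤d (0≤+ 0≤r 0≤r)) 0≤d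
               (ℚ.+-mono-≤ (δ≤1 i) (ℚ.+-mono-≤ r≤B r≤B)) (δ≤η i (ℕ.m⊔n≤o⇒n≤o M N le))) ⟩
        r ℚ.* r ℚ.+ C ℚ.* η                       ≡⟨ cong (r ℚ.* r ℚ.+_) Cη≡ε ⟩
        r ℚ.* r ℚ.+ ε                             ∎)
  where
  open ℚ.≤-Reasoning
  open ℚS using (solve; _:*_; _:+_; _:-_; _:=_)
  δ≤1 : ∀ i → δ i ℚ.≤ 1ℚ
  δ≤1 i = *≤* (ℤ.*-monoˡ-≤-nonNeg (+ 1) (+≤+ (s≤s z≤n)))

-- The ring of complex numbers

infix 4 _≈ᶜ_
record _≈ᶜ_ (z w : ℂ) : Set where
  constructor _,ᶜ_
  field
    re≈ : re z ≈ re w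
    im≈ : im z ≈ im w

≈ᶜ⇒≃ᶜ : ∀ z w → z ≈ᶜ w → z ≃ᶜ w
≈ᶜ⇒≃ᶜ _ _ (mk≈ p ,ᶜ mk≈ q) = p , q

≃ᶜ⇒≈ᶜ : ∀ z w → z ≃ᶜ w → z ≈ᶜ w
≃ᶜ⇒≈ᶜ _ _ (p , q) = mk≈ p ,ᶜ mk≈ q

pointwiseᶜ : ∀ {z w} → (∀ i → seq (re z) i ≡ seq (re w) i) →
             (∀ i → seq (im z) i ≡ seq (im w) i) → z ≈ᶜ w
pointwiseᶜ p q = pointwise p ,ᶜ pointwise q

infix 8 -ᶜ_
-ᶜ_ : ℂ → ℂ
-ᶜ z = (- re z) +i (- im z)

ι : ℝ → ℂ
ι x = x +i 0ℝ

1ᶜ : ℂ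
1ᶜ = ι (fromℚ 1ℚ)

≈ᶜ-refl : ∀ {z} → z ≈ᶜ z
≈ᶜ-refl {z} = ≈-refl {re z} ,ᶜ ≈-refl {im z}

≈ᶜ-sym : ∀ {z w} → z ≈ᶜ w → w ≈ᶜ z
≈ᶜ-sym {z} {w} (p ,ᶜ q) = ≈-sym {re z} {re w} p ,ᶜ ≈-sym {im z} {im w} q

≈ᶜ-trans : ∀ {z w u} → z ≈ᶜ w → w ≈ᶜ u → z ≈ᶜ u
≈ᶜ-trans {z} {w} {u} (p ,ᶜ q) (r ,ᶜ s) =
  ≈-trans {re z} {re w} {re u} p r ,ᶜ ≈-trans {im z} {im w} {im u} q s

+ᶜ-cong : ∀ {z z′ w w′} → z ≈ᶜ z′ → w ≈ᶜ w′ → z +ᶜ w ≈ᶜ z′ +ᶜ w′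
+ᶜ-cong {z} {z′} {w} {w′} (p ,ᶜ q) (r ,ᶜ s) =
  +-cong {re z} {re z′} {re w} {re w′} p r ,ᶜ +-cong {im z} {im z′} {im w} {im w′} q s

-ᶜ-cong : ∀ {z w} → z ≈ᶜ w → -ᶜ z ≈ᶜ -ᶜ w
-ᶜ-cong {z} {w} (p ,ᶜ q) = -‿cong {re z} {re w} p ,ᶜ -‿cong {im z} {im w} q

*ᶜ-cong : ∀ {z z′ w w′} → z ≈ᶜ z′ → w ≈ᶜ w′ → z *ᶜ w ≈ᶜ z′ *ᶜ w′
*ᶜ-cong {a +i b} {a′ +i b′} {c +i d} {c′ +i d′} (p ,ᶜ q) (r ,ᶜ s) =
  +-cong {a * c} {a′ * c′} {(- (b * d))} {(- (b′ * d′))} (*-cong {a} {a′} {c} {c′} p r)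
    (-‿cong {b * d} {b′ * d′} (*-cong {b} {b′} {d} {d′} q s)) ,ᶜ
  +-cong {a * d} {a′ * d′} {b * c} {b′ * c′}
    (*-cong {a} {a′} {d} {d′} p s) (*-cong {b} {b′} {c} {c′} q r)

-- The coordinates of 0ℝ are ℤ→ℚ (+ 0), not literally the 0ℚ of the solver, so the
-- identities below that involve zero are stated for any o ≡ 0ℚ.
0≡ : ℤ→ℚ (+ 0) ≡ 0ℚ
0≡ = refl

module _ where
  open ℚS

  +-identityˡ-0≡ : ∀ {o} → o ≡ 0ℚ → ∀ p → o ℚ.+ p ≡ p
  +-identityˡ-0≡ refl = ℚ.+-identityˡ

  *-re-comm : ∀ a b c d → a ℚ.* c ℚ.- b ℚ.* d ≡ c ℚ.* a ℚ.- d ℚ.* b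
  *-re-comm = solve 4 (λ a b c d → a :* c :- b :* d := c :* a :- d :* b) refl

  *-im-comm : ∀ a b c d → a ℚ.* d ℚ.+ b ℚ.* c ≡ c ℚ.* b ℚ.+ d ℚ.* a
  *-im-comm = solve 4 (λ a b c d → a :* d :+ b :* c := c :* b :+ d :* a) refl

  *-re-assoc : ∀ a b c d e f →
    (a ℚ.* c ℚ.- b ℚ.* d) ℚ.* e ℚ.- (a ℚ.* d ℚ.+ b ℚ.* c) ℚ.* f ≡ a ℚ.* (c ℚ.* e ℚ.- d ℚ.* f) ℚ.- b ℚ.* (c ℚ.* f ℚ.+ d ℚ.* e)
  *-re-assoc = solve 6 (λ a b c d e f →
    (a :* c :- b :* d) :* e :- (a :* d :+ b :* c) :* f :=
    a :* (c :* e :- d :* f) :- b :* (c :* f :+ d :* e)) refl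

  *-im-assoc : ∀ a b c d e f →
    (a ℚ.* c ℚ.- b ℚ.* d) ℚ.* f ℚ.+ (a ℚ.* d ℚ.+ b ℚ.* c) ℚ.* e ≡ a ℚ.* (c ℚ.* f ℚ.+ d ℚ.* e) ℚ.+ b ℚ.* (c ℚ.* e ℚ.- d ℚ.* f)
  *-im-assoc = solve 6 (λ a b c d e f →
    (a :* c :- b :* d) :* f :+ (a :* d :+ b :* c) :* e :=
    a :* (c :* f :+ d :* e) :+ b :* (c :* e :- d :* f)) refl

  *-re-distribʳ : ∀ a b c d e f →
    (c ℚ.+ e) ℚ.* a ℚ.- (d ℚ.+ f) ℚ.* b ≡ (c ℚ.* a ℚ.- d ℚ.* b) ℚ.+ (e ℚ.* a ℚ.- f ℚ.* b)
  *-re-distribʳ = solve 6 (λ a b c d e f →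
    (c :+ e) :* a :- (d :+ f) :* b := (c :* a :- d :* b) :+ (e :* a :- f :* b)) refl

  *-im-distribʳ : ∀ a b c d e f →
    (c ℚ.+ e) ℚ.* b ℚ.+ (d ℚ.+ f) ℚ.* a ≡ (c ℚ.* b ℚ.+ d ℚ.* a) ℚ.+ (e ℚ.* b ℚ.+ f ℚ.* a)
  *-im-distribʳ = solve 6 (λ a b c d e f →
    (c :+ e) :* b :+ (d :+ f) :* a := (c :* b :+ d :* a) :+ (e :* b :+ f :* a)) refl

  *-re-distribˡ : ∀ a b c d e f →
    a ℚ.* (c ℚ.+ e) ℚ.- b ℚ.* (d ℚ.+ f) ≡ (a ℚ.* c ℚ.- b ℚ.* d) ℚ.+ (a ℚ.* e ℚ.- b ℚ.* f)
  *-re-distribˡ = solve 6 (λ a b c d e f →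
    a :* (c :+ e) :- b :* (d :+ f) := (a :* c :- b :* d) :+ (a :* e :- b :* f)) refl

  *-im-distribˡ : ∀ a b c d e f →
    a ℚ.* (d ℚ.+ f) ℚ.+ b ℚ.* (c ℚ.+ e) ≡ (a ℚ.* d ℚ.+ b ℚ.* c) ℚ.+ (a ℚ.* f ℚ.+ b ℚ.* e)
  *-im-distribˡ = solve 6 (λ a b c d e f →
    a :* (d :+ f) :+ b :* (c :+ e) := (a :* d :+ b :* c) :+ (a :* f :+ b :* e)) refl

  re-real* : ∀ {o} → o ≡ 0ℚ → ∀ a d → a ℚ.- o ℚ.* d ≡ a
  re-real* refl = solve 2 (λ a d → a :- con 0ℚ :* d := a) refl

  im-real* : ∀ {o} → o ≡ 0ℚ → ∀ a c → a ℚ.+ o ℚ.* c ≡ a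
  im-real* refl = solve 2 (λ a c → a :+ con 0ℚ :* c := a) refl

  -- With `norm*im`, the two coordinates of the identity that the squared modulus of `z` times `w`
  -- is the conjugate of `z` times `z w`, for `z = a + i b` and `w = c + i d`.
  norm*re : ∀ a b c d → (a ℚ.* a ℚ.+ b ℚ.* b) ℚ.* c ≡
    a ℚ.* (a ℚ.* c ℚ.- b ℚ.* d) ℚ.+ b ℚ.* (a ℚ.* d ℚ.+ b ℚ.* c)
  norm*re = solve 4 (λ a b c d → (a :* a :+ b :* b) :* c :=
    a :* (a :* c :- b :* d) :+ b :* (a :* d :+ b :* c)) refl

  norm*im : ∀ a b c d → (a ℚ.* a ℚ.+ b ℚ.* b) ℚ.* d ≡
    a ℚ.* (a ℚ.* d ℚ.+ b ℚ.* c) ℚ.+ (ℚ.- b) ℚ.* (a ℚ.* c ℚ.- b ℚ.* d)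
  norm*im = solve 4 (λ a b c d → (a :* a :+ b :* b) :* d :=
    a :* (a :* d :+ b :* c) :+ (:- b) :* (a :* c :- b :* d)) refl

  a0+b0≡0 : ∀ {o} → o ≡ 0ℚ → ∀ a b → a ℚ.* o ℚ.+ b ℚ.* o ≡ o
  a0+b0≡0 refl = solve 2 (λ a b → a :* con 0ℚ :+ b :* con 0ℚ := con 0ℚ) refl

  im-0* : ∀ {o} → o ≡ 0ℚ → ∀ a c → o ≡ a ℚ.* o ℚ.+ o ℚ.* c
  im-0* refl = solve 2 (λ a c → con 0ℚ := a :* con 0ℚ :+ con 0ℚ :* c) refl

+ᶜ-comm : ∀ z w → z +ᶜ w ≈ᶜ w +ᶜ z
+ᶜ-comm (a +i b) (c +i d) = pointwiseᶜ
  (λ i → ℚ.+-comm (seq a i) (seq c i)) (λ i → ℚ.+-comm (seq b i) (seq d i))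

+ᶜ-assoc : ∀ z w u → (z +ᶜ w) +ᶜ u ≈ᶜ z +ᶜ (w +ᶜ u)
+ᶜ-assoc (a +i b) (c +i d) (e +i f) = pointwiseᶜ
  (λ i → ℚ.+-assoc (seq a i) (seq c i) (seq e i))
  (λ i → ℚ.+-assoc (seq b i) (seq d i) (seq f i))

+ᶜ-identityˡ : ∀ z → 0ᶜ +ᶜ z ≈ᶜ z
+ᶜ-identityˡ (a +i b) = pointwiseᶜ
  (λ i → +-identityˡ-0≡ 0≡ (seq a i)) (λ i → +-identityˡ-0≡ 0≡ (seq b i))

+ᶜ-inverseˡ : ∀ z → -ᶜ z +ᶜ z ≈ᶜ 0ᶜ
+ᶜ-inverseˡ (a +i b) = pointwiseᶜ
  (λ i → ℚ.+-inverseˡ (seq a i)) (λ i → ℚ.+-inverseˡ (seq b i))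

*ᶜ-comm : ∀ z w → z *ᶜ w ≈ᶜ w *ᶜ z
*ᶜ-comm (a +i b) (c +i d) = pointwiseᶜ
  (λ i → *-re-comm (seq a i) (seq b i) (seq c i) (seq d i))
  (λ i → *-im-comm (seq a i) (seq b i) (seq c i) (seq d i))

*ᶜ-assoc : ∀ z w u → (z *ᶜ w) *ᶜ u ≈ᶜ z *ᶜ (w *ᶜ u)
*ᶜ-assoc (a +i b) (c +i d) (e +i f) = pointwiseᶜ
  (λ i → *-re-assoc (seq a i) (seq b i) (seq c i) (seq d i) (seq e i) (seq f i))
  (λ i → *-im-assoc (seq a i) (seq b i) (seq c i) (seq d i) (seq e i) (seq f i))

*ᶜ-distribˡ : ∀ z w u → z *ᶜ (w +ᶜ u) ≈ᶜ z *ᶜ w +ᶜ z *ᶜ u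
*ᶜ-distribˡ (a +i b) (c +i d) (e +i f) = pointwiseᶜ
  (λ i → *-re-distribˡ (seq a i) (seq b i) (seq c i) (seq d i) (seq e i) (seq f i))
  (λ i → *-im-distribˡ (seq a i) (seq b i) (seq c i) (seq d i) (seq e i) (seq f i))

*ᶜ-distribʳ : ∀ z w u → (w +ᶜ u) *ᶜ z ≈ᶜ w *ᶜ z +ᶜ u *ᶜ z
*ᶜ-distribʳ (a +i b) (c +i d) (e +i f) = pointwiseᶜ
  (λ i → *-re-distribʳ (seq a i) (seq b i) (seq c i) (seq d i) (seq e i) (seq f i))
  (λ i → *-im-distribʳ (seq a i) (seq b i) (seq c i) (seq d i) (seq e i) (seq f i))

*ᶜ-identityˡ : ∀ z → 1ᶜ *ᶜ z ≈ᶜ z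
*ᶜ-identityˡ (a +i b) = pointwiseᶜ
  (λ i → trans (re-real* 0≡ (1ℚ ℚ.* seq a i) (seq b i)) (ℚ.*-identityˡ (seq a i)))
  (λ i → trans (im-real* 0≡ (1ℚ ℚ.* seq b i) (seq a i)) (ℚ.*-identityˡ (seq b i)))

+ᶜ-identityʳ : ∀ z → z +ᶜ 0ᶜ ≈ᶜ z
+ᶜ-identityʳ z = ≈ᶜ-trans {z +ᶜ 0ᶜ} {0ᶜ +ᶜ z} {z} (+ᶜ-comm z 0ᶜ) (+ᶜ-identityˡ z)

+ᶜ-inverseʳ : ∀ z → z +ᶜ -ᶜ z ≈ᶜ 0ᶜ
+ᶜ-inverseʳ z = ≈ᶜ-trans {z +ᶜ -ᶜ z} { -ᶜ z +ᶜ z} {0ᶜ} (+ᶜ-comm z (-ᶜ z)) (+ᶜ-inverseˡ z)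

*ᶜ-identityʳ : ∀ z → z *ᶜ 1ᶜ ≈ᶜ z
*ᶜ-identityʳ z = ≈ᶜ-trans {z *ᶜ 1ᶜ} {1ᶜ *ᶜ z} {z} (*ᶜ-comm z 1ᶜ) (*ᶜ-identityˡ z)

-- Multiplying by the conjugate of `z` turns the factor into the real number `n = a² + b²`, so each
-- coordinate of `w` falls to the real cancellation law. If `n` were zero, both `a` and `b` would
-- be.
*ᶜ-cancelˡ-0 : ∀ {z w} → ¬ (z ≈ᶜ 0ᶜ) → z *ᶜ w ≈ᶜ 0ᶜ → w ≈ᶜ 0ᶜ
*ᶜ-cancelˡ-0 {z@(a +i b)} {w@(c +i d)} z≉0 (zw-re ,ᶜ zw-im) =
  *-cancelˡ-0 {n} {c} n≉0
    (≈-trans {n * c} {a * x + b * y} {0ℝ}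
      (pointwise λ i → norm*re (seq a i) (seq b i) (seq c i) (seq d i)) (null {x} {y} a b zw-re zw-im)) ,ᶜ
  *-cancelˡ-0 {n} {d} n≉0
    (≈-trans {n * d} {a * y + (- b) * x} {0ℝ}
      (pointwise λ i → norm*im (seq a i) (seq b i) (seq c i) (seq d i)) (null {y} {x} a (- b) zw-im zw-re))
  where
  n x y : ℝ
  n = a * a + b * b
  x = re (z *ᶜ w)
  y = im (z *ᶜ w)
  n≉0 : ¬ (n ≈ 0ℝ)
  n≉0 n≈0 = z≉0 (x²+y²≈0⇒x≈0 a b n≈0 ,ᶜ x²+y²≈0⇒x≈0 b a
    (≈-trans {b * b + a * a} {n} {0ℝ} (+-comm (b * b) (a * a)) n≈0))
  null : ∀ {x y} a b → x ≈ 0ℝ → y ≈ 0ℝ → a * x + b * y ≈ 0ℝ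
  null {x} {y} a b x≈0 y≈0 =
    ≈-trans {a * x + b * y} {a * 0ℝ + b * 0ℝ} {0ℝ}
      (+-cong {a * x} {a * 0ℝ} {b * y} {b * 0ℝ}
        (*-cong {a} {a} {x} {0ℝ} (≈-refl {a}) x≈0) (*-cong {b} {b} {y} {0ℝ} (≈-refl {b}) y≈0))
      (pointwise λ i → a0+b0≡0 0≡ (seq a i) (seq b i))

isCommutativeRingᶜ : IsCommutativeRing _≈ᶜ_ _+ᶜ_ _*ᶜ_ -ᶜ_ 0ᶜ 1ᶜ
isCommutativeRingᶜ = record
  { isRing = record
    { +-isAbelianGroup = record
      { isGroup = record
        { isMonoid = record
          { isSemigroup = record
            { isMagma = record
              { isEquivalence = record { refl = ≈ᶜ-refl ; sym = ≈ᶜ-sym ; trans = ≈ᶜ-trans }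
              ; ∙-cong        = +ᶜ-cong
              }
            ; assoc = +ᶜ-assoc
            }
          ; identity = +ᶜ-identityˡ , +ᶜ-identityʳ
          }
        ; inverse = +ᶜ-inverseˡ , +ᶜ-inverseʳ
        ; ⁻¹-cong = -ᶜ-cong
        }
      ; comm = +ᶜ-comm
      }
    ; *-cong     = *ᶜ-cong
    ; *-assoc    = *ᶜ-assoc
    ; *-identity = *ᶜ-identityˡ , *ᶜ-identityʳ
    ; distrib    = *ᶜ-distribˡ , *ᶜ-distribʳ
    }
  ; *-comm = *ᶜ-comm
  }

-- An algebra structure over ℚ, in the shape that the ring solver expects of its coefficients.
ℚ→_ : CommutativeRing 0ℓ 0ℓ → Set
ℚ→ R = ℚ.+-*-rawRing -Raw-AlmostCommutative⟶ fromCommutativeRing R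

-- Opaque copies of the operations: without them, comparing two complex
-- numbers makes Agda compare the Cauchy proofs in their coordinates.
infixl 6 _⊞_
infixl 7 _⊠_
infix  8 ⊟_
opaque
  _⊞_ _⊠_ : ℂ → ℂ → ℂ
  _⊞_ = _+ᶜ_
  _⊠_ = _*ᶜ_

  ⊟_ : ℂ → ℂ
  ⊟_ = -ᶜ_

opaque
  fromℚᶜ : ℚ → ℂ
  fromℚᶜ q = ι (fromℚ q)

  fromℚᶜ≡ι : ∀ q → fromℚᶜ q ≡ ι (fromℚ q)
  fromℚᶜ≡ι _ = refl

  fromℕᶜ≡fromℚᶜ : ∀ a → fromℕᶜ a ≡ fromℚᶜ (ℤ→ℚ (+ a))
  fromℕᶜ≡fromℚᶜ _ = refl

opaque
  unfolding _⊞_ _⊠_ ⊟_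

  isCommutativeRing⊞ : IsCommutativeRing _≈ᶜ_ _⊞_ _⊠_ ⊟_ 0ᶜ 1ᶜ
  isCommutativeRing⊞ = isCommutativeRingᶜ

  ⊠≡*ᶜ : ∀ z w → z ⊠ w ≡ z *ᶜ w
  ⊠≡*ᶜ _ _ = refl

  ⊠-cancelˡ-0 : ∀ {z w} → ¬ (z ≈ᶜ 0ᶜ) → z ⊠ w ≈ᶜ 0ᶜ → w ≈ᶜ 0ᶜ
  ⊠-cancelˡ-0 {z} {w} = *ᶜ-cancelˡ-0 {z} {w}

  -- Here and in the next two lemmas `x` is given by its terms alone, so that it may be a constant
  -- such as `fromℚ (p ℚ.+ q)` as well as a real sum, and no Cauchy proofs are compared.
  ι-⊞ : ∀ {x} a b → (∀ i → seq x i ≡ seq a i ℚ.+ seq b i) → ι x ≈ᶜ ι a ⊞ ι b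
  ι-⊞ a b x≡ = pointwiseᶜ x≡ (λ _ → refl)

  ι-⊠ : ∀ {x} a b → (∀ i → seq x i ≡ seq a i ℚ.* seq b i) → ι x ≈ᶜ ι a ⊠ ι b
  ι-⊠ a b x≡ = pointwiseᶜ
    (λ i → trans (x≡ i) (sym (re-real* 0≡ (seq a i ℚ.* seq b i) (ℤ→ℚ (+ 0)))))
    (λ i → im-0* 0≡ (seq a i) (seq b i))

  ι-⊟ : ∀ {x} a → (∀ i → seq x i ≡ ℚ.- seq a i) → ι x ≈ᶜ ⊟ ι a
  ι-⊟ a x≡ = pointwiseᶜ x≡ (λ _ → refl)

opaque
  unfolding fromℚᶜ

  fromℚᶜ-+ : ∀ p q → fromℚᶜ (p ℚ.+ q) ≈ᶜ fromℚᶜ p ⊞ fromℚᶜ q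
  fromℚᶜ-+ p q = ι-⊞ {fromℚ (p ℚ.+ q)} (fromℚ p) (fromℚ q) (λ _ → refl)

  fromℚᶜ-* : ∀ p q → fromℚᶜ (p ℚ.* q) ≈ᶜ fromℚᶜ p ⊠ fromℚᶜ q
  fromℚᶜ-* p q = ι-⊠ {fromℚ (p ℚ.* q)} (fromℚ p) (fromℚ q) (λ _ → refl)

  fromℚᶜ-neg : ∀ q → fromℚᶜ (ℚ.- q) ≈ᶜ ⊟ fromℚᶜ q
  fromℚᶜ-neg q = ι-⊟ {fromℚ (ℚ.- q)} (fromℚ q) (λ _ → refl)

  fromℚᶜ-0 : fromℚᶜ 0ℚ ≈ᶜ 0ᶜ
  fromℚᶜ-0 = pointwiseᶜ (λ _ → refl) (λ _ → refl)

  fromℚᶜ-1 : fromℚᶜ 1ℚ ≈ᶜ 1ᶜ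
  fromℚᶜ-1 = pointwiseᶜ (λ _ → refl) (λ _ → refl)

ℂ-commutativeRing : CommutativeRing 0ℓ 0ℓ
ℂ-commutativeRing = record { isCommutativeRing = isCommutativeRing⊞ }

open Sum (CommutativeRing.semiring ℂ-commutativeRing) using (sum-cong-≗) renaming (sum to sumℂ)

ℚ→ℂ : ℚ→ ℂ-commutativeRing
ℚ→ℂ = record
  { ⟦_⟧    = fromℚᶜ
  ; +-homo = fromℚᶜ-+
  ; *-homo = fromℚᶜ-*
  ; -‿homo = fromℚᶜ-neg
  ; 0-homo = fromℚᶜ-0
  ; 1-homo = fromℚᶜ-1
  }

opaque
  unfolding _⊞_ _⊠_

  sumᶜ≡sumℂ : ∀ {n} (f g : Vector ℂ n) → sumᶜ (λ j → f j *ᶜ g j) ≡ sumℂ (λ j → f j ⊠ g j)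
  sumᶜ≡sumℂ f g = refl

signlessLaplacian-row≡ : ∀ {n} (D : Digraph n) i (v : Vector ℂ n) →
  sumᶜ (λ j → signlessLaplacian D i j *ᶜ v j) ≡
  sumℂ (λ j → fromℚᶜ (ℤ→ℚ (+ (outdegreeDiagonal D i j ℕ.+ adjacency D i j))) ⊠ v j)
signlessLaplacian-row≡ D i v = trans (sumᶜ≡sumℂ (λ j → signlessLaplacian D i j) v)
  (sum-cong-≗ (λ j → cong (_⊠ v j) (fromℕᶜ≡fromℚᶜ (outdegreeDiagonal D i j ℕ.+ adjacency D i j))))

module _ {n} (D : Digraph n) where

  laplacianSum : Fin n → Vector ℂ n → ℂ
  laplacianSum i v =
    sumℂ (λ j → fromℚᶜ (ℤ→ℚ (+ (outdegreeDiagonal D i j ℕ.+ adjacency D i j))) ⊠ v j)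

  isEigenvalue : ∀ z (v : Vector ℂ n) → ¬ (∀ i → v i ≈ᶜ 0ᶜ) →
    (∀ i → laplacianSum i v ≈ᶜ z ⊠ v i) → IsEigenvalue (signlessLaplacian D) z
  isEigenvalue z v v≉0 Qv≈zv = v , (λ v≃0 → v≉0 λ i → ≃ᶜ⇒≈ᶜ (v i) 0ᶜ (v≃0 i)) , λ i →
    ≈ᶜ⇒≃ᶜ (sumᶜ (λ j → signlessLaplacian D i j *ᶜ v j)) (z *ᶜ v i)
      (subst₂ _≈ᶜ_ (sym (signlessLaplacian-row≡ D i v)) (⊠≡*ᶜ z (v i)) (Qv≈zv i))

  eigenvector : ∀ z → IsEigenvalue (signlessLaplacian D) z →
    ∃[ v ] ¬ (∀ i → v i ≈ᶜ 0ᶜ) × (∀ i → laplacianSum i v ≈ᶜ z ⊠ v i)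
  eigenvector z (v , v≄0 , Qv≃zv) = v , (λ v≈0 → v≄0 λ i → ≈ᶜ⇒≃ᶜ (v i) 0ᶜ (v≈0 i)) , λ i →
    subst₂ _≈ᶜ_ (signlessLaplacian-row≡ D i v) (sym (⊠≡*ᶜ z (v i)))
      (≃ᶜ⇒≈ᶜ (sumᶜ (λ j → signlessLaplacian D i j *ᶜ v j)) (z *ᶜ v i) (Qv≃zv i))

-- The signless Laplacian over an algebra over the rationals

ℤ→ℚ-+ : ∀ a b → ℤ→ℚ (a ℤ.+ b) ≡ ℤ→ℚ a ℚ.+ ℤ→ℚ b
ℤ→ℚ-+ a b = ℚ.toℚᵘ-injective (ℚᵘ.≃-trans
  (ℚᵘ.*≡* (cong (ℤ._* + 1) (sym (cong₂ ℤ._+_ (ℤ.*-identityʳ a) (ℤ.*-identityʳ b)))))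
  (ℚᵘ.≃-sym (ℚ.toℚᵘ-homo-+ (ℤ→ℚ a) (ℤ→ℚ b))))

ℤ→ℚ-* : ∀ a b → ℤ→ℚ (a ℤ.* b) ≡ ℤ→ℚ a ℚ.* ℤ→ℚ b
ℤ→ℚ-* a b = ℚ.toℚᵘ-injective (ℚᵘ.≃-sym (ℚ.toℚᵘ-homo-* (ℤ→ℚ a) (ℤ→ℚ b)))

ℤ→ℚ-neg : ∀ a → ℤ→ℚ (ℤ.- a) ≡ ℚ.- ℤ→ℚ a
ℤ→ℚ-neg (+ zero)   = refl
ℤ→ℚ-neg ℤ.+[1+ _ ] = refl
ℤ→ℚ-neg ℤ.-[1+ _ ] = refl

ℤ→ℚ-∸ : ∀ a b → ℤ→ℚ (a ℤ.- b) ≡ ℤ→ℚ a ℚ.- ℤ→ℚ b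
ℤ→ℚ-∸ a b = trans (ℤ→ℚ-+ a (ℤ.- b)) (cong (ℤ→ℚ a ℚ.+_) (ℤ→ℚ-neg b))

-- Adjacency in the digraph with a loop added at every vertex; the loops remove the condition that
-- the endpoints differ, so only the parts matter.
joins : Part → Part → ℕ
joins p q = if does (p ≟ₚ V₂) ∧ does (q ≟ₚ V₁) then 0 else 1

joins-refl : ∀ p → joins p p ≡ 1
joins-refl S  = refl
joins-refl V₁ = refl
joins-refl V₂ = refl

δᵢⱼ : ∀ {n} → Fin n → Fin n → ℕ
δᵢⱼ i j = if does (i Fin.≟ j) then 1 else 0

adjacency+δ≡joins : ∀ n k m (i j : Fin n) →
  adjacency (K⃗ n k m) i j ℕ.+ δᵢⱼ i j ≡ joins (part k m i) (part k m j)
adjacency+δ≡joins n k m i j with i Fin.≟ j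
... | yes refl = sym (joins-refl (part k m i))
... | no  _ with part k m i ≟ₚ V₂ | part k m j ≟ₚ V₁
...   | yes _ | yes _ = refl
...   | yes _ | no  _ = refl
...   | no  _ | _     = refl

-- trace and discriminant are those of the quadratic with roots ρ and ρ′.
module Rationals (k m l : ℕ) where

  n : ℕ
  n = k ℕ.+ m ℕ.+ l

  κ μ ν 2ℚ 3ℚ 4ℚ 8ℚ : ℚ
  κ = ℤ→ℚ (+ k)
  μ = ℤ→ℚ (+ m)
  ν = ℤ→ℚ (+ l)
  2ℚ = 1ℚ ℚ.+ 1ℚ
  3ℚ = ℤ→ℚ (+ 3)
  4ℚ = ℤ→ℚ (+ 4)
  8ℚ = ℤ→ℚ (+ 8)

  trace discriminant : ℤ
  trace        = + 3 ℤ.* + n ℤ.- + m ℤ.- + 4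
  discriminant = (+ n ℤ.- + 3 ℤ.* + m) ℤ.^ 2 ℤ.+ + 8 ℤ.* + m ℤ.* + k

  n≡ : ℤ→ℚ (+ n) ≡ κ ℚ.+ μ ℚ.+ ν
  n≡ = trans (ℤ→ℚ-+ (+ (k ℕ.+ m)) (+ l)) (cong (ℚ._+ ν) (ℤ→ℚ-+ (+ k) (+ m)))

  trace≡ : ℤ→ℚ trace ≡ 3ℚ ℚ.* (κ ℚ.+ μ ℚ.+ ν) ℚ.- μ ℚ.- 4ℚ
  trace≡ = trans (ℤ→ℚ-∸ (+ 3 ℤ.* + n ℤ.- + m) (+ 4)) (cong (ℚ._- 4ℚ)
    (trans (ℤ→ℚ-∸ (+ 3 ℤ.* + n) (+ m)) (cong (ℚ._- μ)
      (trans (ℤ→ℚ-* (+ 3) (+ n)) (cong (3ℚ ℚ.*_) n≡)))))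

  n-3m≡ : ℤ→ℚ (+ n ℤ.- + 3 ℤ.* + m) ≡ (κ ℚ.+ μ ℚ.+ ν) ℚ.- 3ℚ ℚ.* μ
  n-3m≡ = trans (ℤ→ℚ-∸ (+ n) (+ 3 ℤ.* + m)) (cong₂ ℚ._-_ n≡ (ℤ→ℚ-* (+ 3) (+ m)))

  discriminant≡ : ℤ→ℚ discriminant ≡
    ((κ ℚ.+ μ ℚ.+ ν) ℚ.- 3ℚ ℚ.* μ) ℚ.* ((κ ℚ.+ μ ℚ.+ ν) ℚ.- 3ℚ ℚ.* μ) ℚ.+ 8ℚ ℚ.* μ ℚ.* κ
  discriminant≡ = trans (ℤ→ℚ-+ (a ℤ.^ 2) (+ 8 ℤ.* + m ℤ.* + k)) (cong₂ ℚ._+_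
    (trans (cong ℤ→ℚ (cong (a ℤ.*_) (ℤ.*-identityʳ a)))
      (trans (ℤ→ℚ-* a a) (cong₂ ℚ._*_ n-3m≡ n-3m≡)))
    (trans (ℤ→ℚ-* (+ 8 ℤ.* + m) (+ k)) (cong (ℚ._* κ) (ℤ→ℚ-* (+ 8) (+ m)))))
    where a = + n ℤ.- + 3 ℤ.* + m

  -- One less than the outdegree of a vertex in the part, as `κ + μ + ν` is the number of vertices.
  shift : Part → ℚ
  shift S  = κ ℚ.+ μ ℚ.+ ν ℚ.- 2ℚ
  shift V₁ = κ ℚ.+ μ ℚ.+ ν ℚ.- 2ℚ
  shift V₂ = κ ℚ.+ ν ℚ.- 2ℚ

module SignlessLaplacian (R : CommutativeRing 0ℓ 0ℓ) (ℚ→R : ℚ→ R) where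

  private module R = CommutativeRing R
  open R using (Carrier; 0#; 1#)
    renaming (_≈_ to infix 4 _≋_; _+_ to infixl 6 _⊕_; _*_ to infixl 7 _⊗_; -_ to infix 8 ⊖_)
  open import Algebra.Properties.Semiring.Sum R.semiring
    using (sum; sum-cong-≋; sum-replicate-zero; ∑-distrib-+; *-distribˡ-sum)
  open import Relation.Binary.Reasoning.Setoid R.setoid
  open _-Raw-AlmostCommutative⟶_ ℚ→R renaming (⟦_⟧ to fromQ)
  open RingSolver ℚ.+-*-rawRing (fromCommutativeRing R) ℚ→R
    (λ p q → Maybe.map (λ p≡q → R.reflexive (cong fromQ p≡q)) (dec⇒maybe (p ℚ.≟ q)))
    using (solve; con; _:+_; _:*_; _:-_; _:=_)

  -- Natural multiples and sums over vertices

  fromN : ℕ → Carrier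
  fromN n = fromQ (ℤ→ℚ (+ n))

  fromN-+ : ∀ a b → fromN (a ℕ.+ b) ≋ fromN a ⊕ fromN b
  fromN-+ a b = R.trans (R.reflexive (cong fromQ (ℤ→ℚ-+ (+ a) (+ b))))
    (+-homo (ℤ→ℚ (+ a)) (ℤ→ℚ (+ b)))

  fromN-0 : fromN 0 ≋ 0#
  fromN-0 = R.trans (R.reflexive (cong fromQ {ℤ→ℚ (+ 0)} {0ℚ} refl)) 0-homo

  fromN-1 : fromN 1 ≋ 1#
  fromN-1 = R.trans (R.reflexive (cong fromQ {ℤ→ℚ (+ 1)} {1ℚ} refl)) 1-homo

  0⊗ : ∀ x → fromN 0 ⊗ x ≋ 0#
  0⊗ x = R.trans (R.*-congʳ fromN-0) (R.zeroˡ x)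

  1⊗ : ∀ x → fromN 1 ⊗ x ≋ x
  1⊗ x = R.trans (R.*-congʳ fromN-1) (R.*-identityˡ x)

  suc⊗ : ∀ k x → fromN (suc k) ⊗ x ≋ x ⊕ fromN k ⊗ x
  suc⊗ k x = begin
    fromN (1 ℕ.+ k) ⊗ x         ≈⟨ R.*-congʳ (fromN-+ 1 k) ⟩
    (fromN 1 ⊕ fromN k) ⊗ x     ≈⟨ R.distribʳ x (fromN 1) (fromN k) ⟩
    fromN 1 ⊗ x ⊕ fromN k ⊗ x   ≈⟨ R.+-congʳ (1⊗ x) ⟩
    x ⊕ fromN k ⊗ x             ∎

  sum-constant : ∀ l x → sum {l} (λ _ → x) ≋ fromN l ⊗ x
  sum-constant zero    x = R.sym (0⊗ x)
  sum-constant (suc l) x = R.trans (R.+-congˡ (sum-constant l x)) (R.sym (suc⊗ l x))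

  sum-δ : ∀ {n} (i : Fin n) d (v : Vector Carrier n) →
    sum (λ j → fromN (if does (i Fin.≟ j) then d else 0) ⊗ v j) ≋ fromN d ⊗ v i
  sum-δ {suc n} zero d v = begin
    fromN d ⊗ v zero ⊕ sum (λ j → fromN 0 ⊗ v (suc j))
      ≈⟨ R.+-congˡ (R.trans (sum-cong-≋ (λ j → 0⊗ (v (suc j)))) (sum-replicate-zero n)) ⟩
    fromN d ⊗ v zero ⊕ 0#
      ≈⟨ R.+-identityʳ _ ⟩
    fromN d ⊗ v zero ∎
  sum-δ {suc n} (suc i) d v =
    R.trans (R.+-cong (0⊗ (v zero)) (sum-δ i d (λ j → v (suc j)))) (R.+-identityˡ _)

  fromN-card : ∀ {n} (b : Fin n → Bool) →
    fromN (card (tabulate b)) ≋ sum (λ j → fromN (if b j then 1 else 0))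
  fromN-card {zero}  b = fromN-0
  fromN-card {suc n} b with b zero
  ... | true  = R.trans (fromN-+ 1 (card (tabulate (λ j → b (suc j)))))
                  (R.+-congˡ (fromN-card (λ j → b (suc j))))
  ... | false = R.trans (R.sym (R.+-identityˡ _))
                  (R.+-cong (R.sym fromN-0) (fromN-card (λ j → b (suc j))))

  module _ {n} (D : Digraph n) where

    outSum : Fin n → Vector Carrier n → Carrier
    outSum i v = sum (λ j → fromN (adjacency D i j) ⊗ v j)

    -- Makes the outdegree an instance of `outSum`, so that one evaluation of row sums serves both
    -- the diagonal and the adjacency entries.
    fromN-outdegree : ∀ i → fromN (outdegree D i) ≋ outSum i (λ _ → 1#)
    fromN-outdegree i = begin
      fromN (outdegree D i)
        ≈⟨ fromN-card (λ j → does (Digraph.arc? D i j)) ⟩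
      sum (λ j → fromN (adjacency D i j))
        ≈⟨ sum-cong-≋ (λ j → R.*-identityʳ (fromN (adjacency D i j))) ⟨
      outSum i (λ _ → 1#) ∎

    signlessLaplacian-row : ∀ i v →
      sum (λ j → fromN (outdegreeDiagonal D i j ℕ.+ adjacency D i j) ⊗ v j) ≋
      outSum i (λ _ → 1#) ⊗ v i ⊕ outSum i v
    signlessLaplacian-row i v = begin
      sum (λ j → fromN (outdegreeDiagonal D i j ℕ.+ adjacency D i j) ⊗ v j)
        ≈⟨ sum-cong-≋ (λ j → R.trans (R.*-congʳ (fromN-+ (outdegreeDiagonal D i j) (adjacency D i j)))
             (R.distribʳ (v j) (fromN (outdegreeDiagonal D i j)) (fromN (adjacency D i j)))) ⟩
      sum (λ j → fromN (outdegreeDiagonal D i j) ⊗ v j ⊕ fromN (adjacency D i j) ⊗ v j)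
        ≈⟨ ∑-distrib-+ (λ j → fromN (outdegreeDiagonal D i j) ⊗ v j) (λ j → fromN (adjacency D i j) ⊗ v j) ⟩
      sum (λ j → fromN (outdegreeDiagonal D i j) ⊗ v j) ⊕ outSum i v
        ≈⟨ R.+-congʳ (R.trans (sum-δ i (outdegree D i) v) (R.*-congʳ (fromN-outdegree i))) ⟩
      outSum i (λ _ → 1#) ⊗ v i ⊕ outSum i v ∎

  -- Vertex 0 lies in the first nonempty part, and once it is removed the renumbered vertices fall
  -- by computation into the parts with that size lowered by 1. Hence the induction on `k`, then on
  -- `m`, until `V₂` alone is left.
  sum-parts : ∀ k m l (h : Part → Carrier) →
    sum {k ℕ.+ m ℕ.+ l} (λ j → h (part k m j)) ≋
    fromN k ⊗ h S ⊕ fromN m ⊗ h V₁ ⊕ fromN l ⊗ h V₂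
  sum-parts zero zero l h = R.trans (sum-constant l (h V₂)) (R.sym (begin
    fromN 0 ⊗ h S ⊕ fromN 0 ⊗ h V₁ ⊕ fromN l ⊗ h V₂
      ≈⟨ R.+-congʳ (R.trans (R.+-cong (0⊗ (h S)) (0⊗ (h V₁))) (R.+-identityˡ 0#)) ⟩
    0# ⊕ fromN l ⊗ h V₂
      ≈⟨ R.+-identityˡ _ ⟩
    fromN l ⊗ h V₂ ∎))
  sum-parts zero (suc m) l h = begin
    h V₁ ⊕ sum {m ℕ.+ l} (λ j → h (part zero m j))
      ≈⟨ R.+-congˡ (sum-parts zero m l h) ⟩
    h V₁ ⊕ (fromN 0 ⊗ h S ⊕ fromN m ⊗ h V₁ ⊕ fromN l ⊗ h V₂)
      ≈⟨ solve 4 (λ x a b c → x :+ (a :+ b :+ c) := a :+ (x :+ b) :+ c) R.refl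
           (h V₁) (fromN 0 ⊗ h S) (fromN m ⊗ h V₁) (fromN l ⊗ h V₂) ⟩
    fromN 0 ⊗ h S ⊕ (h V₁ ⊕ fromN m ⊗ h V₁) ⊕ fromN l ⊗ h V₂
      ≈⟨ R.+-congʳ (R.+-congˡ (suc⊗ m (h V₁))) ⟨
    fromN 0 ⊗ h S ⊕ fromN (suc m) ⊗ h V₁ ⊕ fromN l ⊗ h V₂ ∎
  sum-parts (suc k) m l h = begin
    h S ⊕ sum {k ℕ.+ m ℕ.+ l} (λ j → h (part k m j))
      ≈⟨ R.+-congˡ (sum-parts k m l h) ⟩
    h S ⊕ (fromN k ⊗ h S ⊕ fromN m ⊗ h V₁ ⊕ fromN l ⊗ h V₂)
      ≈⟨ solve 4 (λ x a b c → x :+ (a :+ b :+ c) := x :+ a :+ b :+ c) R.refl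
           (h S) (fromN k ⊗ h S) (fromN m ⊗ h V₁) (fromN l ⊗ h V₂) ⟩
    h S ⊕ fromN k ⊗ h S ⊕ fromN m ⊗ h V₁ ⊕ fromN l ⊗ h V₂
      ≈⟨ R.+-congʳ (R.+-congʳ (suc⊗ k (h S))) ⟨
    fromN (suc k) ⊗ h S ⊕ fromN m ⊗ h V₁ ⊕ fromN l ⊗ h V₂ ∎

  module Parts (k m l : ℕ) where

    private module Q = Rationals k m l
    open Q using (n)

    κ μ ν 2# : Carrier
    κ = fromN k
    μ = fromN m
    ν = fromN l
    2# = fromQ Q.2ℚ

    -- The row of Q + I - D, D the outdegree matrix, that belongs to a vertex in part p.
    joinSum : Part → Vector Carrier n → Carrier
    joinSum p v = sum (λ j → fromN (joins p (part k m j)) ⊗ v j)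

    joinSum-parts : ∀ p (h : Part → Carrier) → joinSum p (λ j → h (part k m j)) ≋
      κ ⊗ (fromN (joins p S) ⊗ h S) ⊕ μ ⊗ (fromN (joins p V₁) ⊗ h V₁) ⊕ ν ⊗ (fromN (joins p V₂) ⊗ h V₂)
    joinSum-parts p h = sum-parts k m l (λ q → fromN (joins p q) ⊗ h q)

    full : ∀ x y z → κ ⊗ (fromN 1 ⊗ x) ⊕ μ ⊗ (fromN 1 ⊗ y) ⊕ ν ⊗ (fromN 1 ⊗ z) ≋
      κ ⊗ x ⊕ μ ⊗ y ⊕ ν ⊗ z
    full x y z = R.+-cong (R.+-cong (R.*-congˡ (1⊗ x)) (R.*-congˡ (1⊗ y))) (R.*-congˡ (1⊗ z))

    joinSum-S : ∀ h → joinSum S (λ j → h (part k m j)) ≋ κ ⊗ h S ⊕ μ ⊗ h V₁ ⊕ ν ⊗ h V₂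
    joinSum-S h = R.trans (joinSum-parts S h) (full (h S) (h V₁) (h V₂))

    joinSum-V₂ : ∀ h → joinSum V₂ (λ j → h (part k m j)) ≋ κ ⊗ h S ⊕ ν ⊗ h V₂
    joinSum-V₂ h = begin
      joinSum V₂ (λ j → h (part k m j))
        ≈⟨ joinSum-parts V₂ h ⟩
      κ ⊗ (fromN 1 ⊗ h S) ⊕ μ ⊗ (fromN 0 ⊗ h V₁) ⊕ ν ⊗ (fromN 1 ⊗ h V₂)
        ≈⟨ R.+-cong (R.+-cong (R.*-congˡ (1⊗ (h S))) (R.trans (R.*-congˡ (0⊗ (h V₁))) (R.zeroʳ μ)))
             (R.*-congˡ (1⊗ (h V₂))) ⟩
      κ ⊗ h S ⊕ 0# ⊕ ν ⊗ h V₂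
        ≈⟨ R.+-congʳ (R.+-identityʳ _) ⟩
      κ ⊗ h S ⊕ ν ⊗ h V₂ ∎

    outSum+v≋joinSum : ∀ i v → outSum (K⃗ n k m) i v ⊕ v i ≋ joinSum (part k m i) v
    outSum+v≋joinSum i v = R.sym (begin
      joinSum (part k m i) v
        ≈⟨ sum-cong-≋ (λ j → R.trans
             (R.*-congʳ (R.trans (R.reflexive (cong fromN (sym (adjacency+δ≡joins n k m i j))))
               (fromN-+ (adjacency (K⃗ n k m) i j) (δᵢⱼ i j))))
             (R.distribʳ (v j) (fromN (adjacency (K⃗ n k m) i j)) (fromN (δᵢⱼ i j)))) ⟩
      sum (λ j → fromN (adjacency (K⃗ n k m) i j) ⊗ v j ⊕ fromN (δᵢⱼ i j) ⊗ v j)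
        ≈⟨ ∑-distrib-+ (λ j → fromN (adjacency (K⃗ n k m) i j) ⊗ v j) (λ j → fromN (δᵢⱼ i j) ⊗ v j) ⟩
      outSum (K⃗ n k m) i v ⊕ sum (λ j → fromN (δᵢⱼ i j) ⊗ v j)
        ≈⟨ R.+-congˡ (R.trans (sum-δ i 1 v) (1⊗ (v i))) ⟩
      outSum (K⃗ n k m) i v ⊕ v i ∎)

    shift : Part → Carrier
    shift S  = κ ⊕ μ ⊕ ν ⊕ ⊖ 2#
    shift V₁ = κ ⊕ μ ⊕ ν ⊕ ⊖ 2#
    shift V₂ = κ ⊕ ν ⊕ ⊖ 2#

    joinSum-1 : ∀ p → joinSum p (λ _ → 1#) ⊕ ⊖ 2# ≋ shift p
    joinSum-1 S  = R.+-congʳ (R.trans (joinSum-S (λ _ → 1#))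
      (R.+-cong (R.+-cong (R.*-identityʳ κ) (R.*-identityʳ μ)) (R.*-identityʳ ν)))
    joinSum-1 V₁ = joinSum-1 S
    joinSum-1 V₂ = R.+-congʳ (R.trans (joinSum-V₂ (λ _ → 1#))
      (R.+-cong (R.*-identityʳ κ) (R.*-identityʳ ν)))

    row : ∀ i v →
      sum (λ j → fromN (outdegreeDiagonal (K⃗ n k m) i j ℕ.+ adjacency (K⃗ n k m) i j) ⊗ v j) ≋
      shift (part k m i) ⊗ v i ⊕ joinSum (part k m i) v
    row i v = begin
      sum (λ j → fromN (outdegreeDiagonal (K⃗ n k m) i j ℕ.+ adjacency (K⃗ n k m) i j) ⊗ v j)
        ≈⟨ signlessLaplacian-row (K⃗ n k m) i v ⟩
      a ⊗ v i ⊕ b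
        -- The loop is added to the outdegree `a` and to the row `b`. The first adds `x`, the second
        -- adds `x`, and the 2 takes both back.
        ≈⟨ solve 3 (λ a b x → a :* x :+ b :=
             ((a :+ con 1ℚ) :- con Q.2ℚ) :* x :+ (b :+ x)) R.refl a b (v i) ⟩
      ((a ⊕ fromQ 1ℚ) ⊕ ⊖ 2#) ⊗ v i ⊕ (b ⊕ v i)
        ≈⟨ R.+-cong (R.*-congʳ (R.+-congʳ (R.trans (R.+-congˡ 1-homo) (outSum+v≋joinSum i (λ _ → 1#)))))
             (outSum+v≋joinSum i v) ⟩
      (joinSum (part k m i) (λ _ → 1#) ⊕ ⊖ 2#) ⊗ v i ⊕ joinSum (part k m i) v
        ≈⟨ R.+-congʳ (R.*-congʳ (joinSum-1 (part k m i))) ⟩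
      shift (part k m i) ⊗ v i ⊕ joinSum (part k m i) v ∎
      where
      a = outSum (K⃗ n k m) i (λ _ → 1#)
      b = outSum (K⃗ n k m) i v

    -- The characteristic polynomial of the quotient matrix with rows `(shift S + κ + μ, ν)` and
    -- `(κ, shift V₂ + ν)`, by which the signless Laplacian acts on vectors constant on `S ∪ V₁` and
    -- on `V₂`.
    char : Carrier → Carrier
    char z = (z ⊕ ⊖ shift V₂ ⊕ ⊖ ν) ⊗ (z ⊕ ⊖ shift S ⊕ ⊖ (κ ⊕ μ)) ⊕ ⊖ (κ ⊗ ν)

    difference-0 : ∀ {x y} → x ≋ y → x ⊕ ⊖ y ≋ 0#
    difference-0 {x} {y} x≋y = R.trans (R.+-congʳ x≋y) (R.-‿inverseʳ y)

    -- Cramer's rule: the first equation times `x y - ν x`, the coefficient of `t′` in the second,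
    -- plus the second times `ν x`. The terms in `t′` cancel and the coefficient of `t` is `x y`
    -- times `char z`.
    eliminate : ∀ {z t t′} → let x = z ⊕ ⊖ shift S ; y = z ⊕ ⊖ shift V₂ in
      x ⊗ y ⊗ t ≋ κ ⊗ (y ⊗ t) ⊕ μ ⊗ (y ⊗ t) ⊕ ν ⊗ (x ⊗ t′) →
      x ⊗ y ⊗ t′ ≋ κ ⊗ (y ⊗ t) ⊕ ν ⊗ (x ⊗ t′) →
      x ⊗ (y ⊗ (char z ⊗ t)) ≋ 0#
    eliminate {z} {t} {t′} e e′ = begin
      x ⊗ (y ⊗ (char z ⊗ t))
        ≈⟨ solve 7 (λ x y t t′ κ μ ν →
             x :* (y :* (((y :- ν) :* (x :- (κ :+ μ)) :- κ :* ν) :* t)) :=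
             (x :* y :- ν :* x) :* (x :* y :* t :- (κ :* (y :* t) :+ μ :* (y :* t) :+ ν :* (x :* t′)))
             :+ ν :* x :* (x :* y :* t′ :- (κ :* (y :* t) :+ ν :* (x :* t′))))
             R.refl x y t t′ κ μ ν ⟩
      (x ⊗ y ⊕ ⊖ (ν ⊗ x)) ⊗ (x ⊗ y ⊗ t ⊕ ⊖ (κ ⊗ (y ⊗ t) ⊕ μ ⊗ (y ⊗ t) ⊕ ν ⊗ (x ⊗ t′)))
      ⊕ ν ⊗ x ⊗ (x ⊗ y ⊗ t′ ⊕ ⊖ (κ ⊗ (y ⊗ t) ⊕ ν ⊗ (x ⊗ t′)))
        ≈⟨ R.+-cong (R.trans (R.*-congˡ (difference-0 e)) (R.zeroʳ _))
             (R.trans (R.*-congˡ (difference-0 e′)) (R.zeroʳ _)) ⟩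
      0# ⊕ 0#
        ≈⟨ R.+-identityˡ 0# ⟩
      0# ∎
      where
      x = z ⊕ ⊖ shift S
      y = z ⊕ ⊖ shift V₂

    module Eigenvector {z} (v : Vector Carrier n)
      (Qv≋zv : ∀ i → sum (λ j →
         fromN (outdegreeDiagonal (K⃗ n k m) i j ℕ.+ adjacency (K⃗ n k m) i j) ⊗ v j) ≋ z ⊗ v i)
      where

      x y t t′ : Carrier
      x = z ⊕ ⊖ shift S
      y = z ⊕ ⊖ shift V₂
      t  = joinSum S v
      t′ = joinSum V₂ v

      shifted-row : ∀ i → (z ⊕ ⊖ shift (part k m i)) ⊗ v i ≋ joinSum (part k m i) v
      shifted-row i = begin
        (z ⊕ ⊖ s) ⊗ v i                ≈⟨ solve 3 (λ z s u → (z :- s) :* u := z :* u :- s :* u)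
                                             R.refl z s (v i) ⟩
        z ⊗ v i ⊕ ⊖ (s ⊗ v i)          ≈⟨ R.+-congʳ (R.trans (R.sym (Qv≋zv i)) (row i v)) ⟩
        s ⊗ v i ⊕ r ⊕ ⊖ (s ⊗ v i)      ≈⟨ solve 2 (λ a r → a :+ r :- a := r) R.refl (s ⊗ v i) r ⟩
        r                              ∎
        where
        s = shift (part k m i)
        r = joinSum (part k m i) v

      -- A row determines `v i` only up to its factor `x` or `y`. Multiplied by both, all entries
      -- have a common factor `x ⊗ y` and can be summed without inverses.
      cleared : Part → Carrier
      cleared S  = y ⊗ t
      cleared V₁ = y ⊗ t
      cleared V₂ = x ⊗ t′

      xyv≋cleared : ∀ i → x ⊗ y ⊗ v i ≋ cleared (part k m i)
      xyv≋cleared i = go (part k m i) (shifted-row i)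
        where
        swap : ∀ {r} → x ⊗ v i ≋ r → x ⊗ y ⊗ v i ≋ y ⊗ r
        swap e = R.trans (solve 3 (λ x y u → x :* y :* u := y :* (x :* u)) R.refl x y (v i))
          (R.*-congˡ e)
        go : ∀ p → (z ⊕ ⊖ shift p) ⊗ v i ≋ joinSum p v → x ⊗ y ⊗ v i ≋ cleared p
        go S  e = swap e
        go V₁ e = swap e
        go V₂ e = R.trans (R.*-assoc x y (v i)) (R.*-congˡ e)

      xy-joinSum : ∀ p → x ⊗ y ⊗ joinSum p v ≋ joinSum p (λ j → cleared (part k m j))
      xy-joinSum p = begin
        x ⊗ y ⊗ joinSum p v
          ≈⟨ *-distribˡ-sum (x ⊗ y) (λ j → c j ⊗ v j) ⟩
        sum (λ j → x ⊗ y ⊗ (c j ⊗ v j))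
          ≈⟨ sum-cong-≋ (λ j → R.trans
               (solve 3 (λ w c u → w :* (c :* u) := c :* (w :* u)) R.refl (x ⊗ y) (c j) (v j))
               (R.*-congˡ (xyv≋cleared j))) ⟩
        joinSum p (λ j → cleared (part k m j)) ∎
        where
        c : Vector Carrier n
        c j = fromN (joins p (part k m j))

      xyt : x ⊗ y ⊗ t ≋ κ ⊗ (y ⊗ t) ⊕ μ ⊗ (y ⊗ t) ⊕ ν ⊗ (x ⊗ t′)
      xyt = R.trans (xy-joinSum S) (joinSum-S cleared)

      xyt′ : x ⊗ y ⊗ t′ ≋ κ ⊗ (y ⊗ t) ⊕ ν ⊗ (x ⊗ t′)
      xyt′ = R.trans (xy-joinSum V₂) (joinSum-V₂ cleared)

      char-t≋0 : x ⊗ (y ⊗ (char z ⊗ t)) ≋ 0#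
      char-t≋0 = eliminate xyt xyt′

      -- Once `t` is zero, this is the only surviving term of `xyt`. The other equation `xyt′` would
      -- leave `x (y - ν) t′`, whose factor `y - ν` may vanish.
      νxt′≋0 : t ≋ 0# → ν ⊗ (x ⊗ t′) ≋ 0#
      νxt′≋0 t≋0 = begin
        ν ⊗ (x ⊗ t′)
          ≈⟨ solve 4 (λ a κ μ b → b := (κ :* a :+ μ :* a :+ b) :- (κ :+ μ) :* a)
               R.refl (y ⊗ t) κ μ (ν ⊗ (x ⊗ t′)) ⟩
        (κ ⊗ (y ⊗ t) ⊕ μ ⊗ (y ⊗ t) ⊕ ν ⊗ (x ⊗ t′)) ⊕ ⊖ ((κ ⊕ μ) ⊗ (y ⊗ t))
          ≈⟨ R.+-congʳ xyt ⟨
        x ⊗ y ⊗ t ⊕ ⊖ ((κ ⊕ μ) ⊗ (y ⊗ t))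
          ≈⟨ solve 4 (λ x y t s → x :* y :* t :- s :* (y :* t) := (x :* y :- s :* y) :* t)
               R.refl x y t (κ ⊕ μ) ⟩
        (x ⊗ y ⊕ ⊖ ((κ ⊕ μ) ⊗ y)) ⊗ t
          ≈⟨ R.trans (R.*-congˡ t≋0) (R.zeroʳ _) ⟩
        0# ∎

      -- Contrapositive because it cannot be decided which of the four values `z` equals. The sums
      -- `t` and `t′` vanish in turn, and then the shifted rows leave `x` or `y` times `v i` equal
      -- to zero.
      spectrum : (∀ {a b} → ¬ (a ≋ 0#) → a ⊗ b ≋ 0# → b ≋ 0#) → ¬ (ν ≋ 0#) →
        ¬ (x ≋ 0#) → ¬ (y ≋ 0#) → ¬ (char z ≋ 0#) → ∀ i → v i ≋ 0#
      spectrum cancel ν≉0 x≉0 y≉0 char≉0 i = go (part k m i) (shifted-row i)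
        where
        t≋0 : t ≋ 0#
        t≋0 = cancel char≉0 (cancel y≉0 (cancel x≉0 char-t≋0))
        t′≋0 : t′ ≋ 0#
        t′≋0 = cancel x≉0 (cancel ν≉0 (νxt′≋0 t≋0))
        go : ∀ p → (z ⊕ ⊖ shift p) ⊗ v i ≋ joinSum p v → v i ≋ 0#
        go S  e = cancel x≉0 (R.trans e t≋0)
        go V₁ e = cancel x≉0 (R.trans e t≋0)
        go V₂ e = cancel y≉0 (R.trans e t′≋0)

    -- Solves the first row of the quotient eigenvalue equation, `(z - shift S - (κ + μ)) a = ν b`,
    -- for every `z`. The condition `char z ≋ 0#` is then exactly the second row.
    profile : Carrier → Part → Carrier
    profile z S  = ν
    profile z V₁ = ν
    profile z V₂ = z ⊕ ⊖ shift S ⊕ ⊖ (κ ⊕ μ)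

    profile-eigenvector : ∀ {z} → char z ≋ 0# → ∀ i →
      sum (λ j → fromN (outdegreeDiagonal (K⃗ n k m) i j ℕ.+ adjacency (K⃗ n k m) i j)
        ⊗ profile z (part k m j)) ≋ z ⊗ profile z (part k m i)
    profile-eigenvector {z} char≋0 i =
      R.trans (row i (λ j → profile z (part k m j))) (go (part k m i))
      where
      v : Vector Carrier n
      v j = profile z (part k m j)
      a = shift S
      b = shift V₂
      go : ∀ p → shift p ⊗ profile z p ⊕ joinSum p v ≋ z ⊗ profile z p
      go S = R.trans (R.+-congˡ (joinSum-S (profile z)))
        (solve 5 (λ z a κ μ ν → a :* ν :+ (κ :* ν :+ μ :* ν :+ ν :* (z :- a :- (κ :+ μ)))
          := z :* ν) R.refl z a κ μ ν)
      go V₁ = go S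
      go V₂ = begin
        b ⊗ profile z V₂ ⊕ joinSum V₂ v
          ≈⟨ R.+-congˡ (joinSum-V₂ (profile z)) ⟩
        b ⊗ profile z V₂ ⊕ (κ ⊗ ν ⊕ ν ⊗ profile z V₂)
          ≈⟨ solve 5 (λ z b u κ ν → b :* u :+ (κ :* ν :+ ν :* u) :=
               z :* u :- ((z :- b :- ν) :* u :- κ :* ν)) R.refl z b (profile z V₂) κ ν ⟩
        z ⊗ profile z V₂ ⊕ ⊖ (char z)
          ≈⟨ R.+-congˡ (R.-‿cong char≋0) ⟩
        z ⊗ profile z V₂ ⊕ ⊖ 0#
          ≈⟨ difference-0ʳ ⟩
        z ⊗ profile z V₂ ∎
        where
        difference-0ʳ : z ⊗ profile z V₂ ⊕ ⊖ 0# ≋ z ⊗ profile z V₂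
        difference-0ʳ = R.trans (R.+-congˡ -0#≈0#) (R.+-identityʳ _)
          where open import Algebra.Properties.Ring R.ring using (-0#≈0#)

    -- Trace, discriminant and factorisation of the quadratic

    N≋ : fromQ (Q.κ ℚ.+ Q.μ ℚ.+ Q.ν) ≋ κ ⊕ μ ⊕ ν
    N≋ = R.trans (+-homo (Q.κ ℚ.+ Q.μ) Q.ν) (R.+-congʳ (+-homo Q.κ Q.μ))

    minus-homo : ∀ p q → fromQ (p ℚ.- q) ≋ fromQ p ⊕ ⊖ fromQ q
    minus-homo p q = R.trans (+-homo p (ℚ.- q)) (R.+-congˡ (-‿homo q))

    shift≋ : ∀ p → shift p ≋ fromQ (Q.shift p)
    shift≋ S  = R.sym (R.trans (minus-homo (Q.κ ℚ.+ Q.μ ℚ.+ Q.ν) Q.2ℚ) (R.+-congʳ N≋))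
    shift≋ V₁ = shift≋ S
    shift≋ V₂ = R.sym (R.trans (minus-homo (Q.κ ℚ.+ Q.ν) Q.2ℚ) (R.+-congʳ (+-homo Q.κ Q.ν)))

    fromQ-trace : fromQ (ℤ→ℚ Q.trace) ≋ fromQ Q.3ℚ ⊗ (κ ⊕ μ ⊕ ν) ⊕ ⊖ μ ⊕ ⊖ fromQ Q.4ℚ
    fromQ-trace = begin
      fromQ (ℤ→ℚ Q.trace)
        ≈⟨ R.reflexive (cong fromQ Q.trace≡) ⟩
      fromQ (Q.3ℚ ℚ.* N ℚ.- Q.μ ℚ.- Q.4ℚ)
        ≈⟨ minus-homo (Q.3ℚ ℚ.* N ℚ.- Q.μ) Q.4ℚ ⟩
      fromQ (Q.3ℚ ℚ.* N ℚ.- Q.μ) ⊕ ⊖ fromQ Q.4ℚ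
        ≈⟨ R.+-congʳ (R.trans (minus-homo (Q.3ℚ ℚ.* N) Q.μ)
             (R.+-congʳ (R.trans (*-homo Q.3ℚ N) (R.*-congˡ N≋)))) ⟩
      fromQ Q.3ℚ ⊗ (κ ⊕ μ ⊕ ν) ⊕ ⊖ μ ⊕ ⊖ fromQ Q.4ℚ ∎
      where N = Q.κ ℚ.+ Q.μ ℚ.+ Q.ν

    fromQ-discriminant : let a = κ ⊕ μ ⊕ ν ⊕ ⊖ (fromQ Q.3ℚ ⊗ μ) in
      fromQ (ℤ→ℚ Q.discriminant) ≋ a ⊗ a ⊕ fromQ Q.8ℚ ⊗ μ ⊗ κ
    fromQ-discriminant = begin
      fromQ (ℤ→ℚ Q.discriminant)
        ≈⟨ R.reflexive (cong fromQ Q.discriminant≡) ⟩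
      fromQ (a ℚ.* a ℚ.+ Q.8ℚ ℚ.* Q.μ ℚ.* Q.κ)
        ≈⟨ +-homo (a ℚ.* a) (Q.8ℚ ℚ.* Q.μ ℚ.* Q.κ) ⟩
      fromQ (a ℚ.* a) ⊕ fromQ (Q.8ℚ ℚ.* Q.μ ℚ.* Q.κ)
        ≈⟨ R.+-cong (R.trans (*-homo a a) (R.*-cong a≋ a≋))
             (R.trans (*-homo (Q.8ℚ ℚ.* Q.μ) Q.κ) (R.*-congʳ (*-homo Q.8ℚ Q.μ))) ⟩
      a′ ⊗ a′ ⊕ fromQ Q.8ℚ ⊗ μ ⊗ κ ∎
      where
      a  = (Q.κ ℚ.+ Q.μ ℚ.+ Q.ν) ℚ.- Q.3ℚ ℚ.* Q.μ
      a′ = κ ⊕ μ ⊕ ν ⊕ ⊖ (fromQ Q.3ℚ ⊗ μ)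
      a≋ : fromQ a ≋ a′
      a≋ = R.trans (minus-homo (Q.κ ℚ.+ Q.μ ℚ.+ Q.ν) (Q.3ℚ ℚ.* Q.μ))
        (R.+-cong N≋ (R.-‿cong (*-homo Q.3ℚ Q.μ)))

    -- With trace `t` and discriminant `d` the quadratic is `z² - t z + (t² - d) / 4`. It differs
    -- from the product of the linear factors by `(s² - d) / 4`, so `s` enters only through its
    -- square.
    char-factors : ∀ {s r r′} → s ⊗ s ≋ fromQ (ℤ→ℚ Q.discriminant) →
      r ≋ fromQ ½ ⊗ (fromQ (ℤ→ℚ Q.trace) ⊕ s) → r′ ≋ fromQ ½ ⊗ (fromQ (ℤ→ℚ Q.trace) ⊕ ⊖ s) →
      ∀ z → char z ≋ (z ⊕ ⊖ r) ⊗ (z ⊕ ⊖ r′)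
    char-factors {s} {r} {r′} s² r≋ r′≋ z = begin
      char z
        ≈⟨ solve 5 (λ z s κ μ ν →
             let n = κ :+ μ :+ ν
                 t = con Q.3ℚ :* n :- μ :- con Q.4ℚ
                 d = (n :- con Q.3ℚ :* μ) :* (n :- con Q.3ℚ :* μ) :+ con Q.8ℚ :* μ :* κ
             in (z :- (κ :+ ν :- con Q.2ℚ) :- ν) :* (z :- (n :- con Q.2ℚ) :- (κ :+ μ)) :- κ :* ν :=
                (z :- con ½ :* (t :+ s)) :* (z :- con ½ :* (t :- s))
                :+ con ½ :* con ½ :* (s :* s :- d))
             R.refl z s κ μ ν ⟩
      (z ⊕ ⊖ (fromQ ½ ⊗ (e ⊕ s))) ⊗ (z ⊕ ⊖ (fromQ ½ ⊗ (e ⊕ ⊖ s)))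
      ⊕ fromQ ½ ⊗ fromQ ½ ⊗ (s ⊗ s ⊕ ⊖ d)
        ≈⟨ R.+-cong
             (R.*-cong (R.+-congˡ (R.-‿cong (R.trans (R.*-congˡ (R.+-congʳ (R.sym fromQ-trace))) (R.sym r≋))))
               (R.+-congˡ (R.-‿cong (R.trans (R.*-congˡ (R.+-congʳ (R.sym fromQ-trace))) (R.sym r′≋)))))
             (R.trans (R.*-congˡ (difference-0 (R.trans s² fromQ-discriminant))) (R.zeroʳ _)) ⟩
      (z ⊕ ⊖ r) ⊗ (z ⊕ ⊖ r′) ⊕ 0#
        ≈⟨ R.+-identityʳ _ ⟩
      (z ⊕ ⊖ r) ⊗ (z ⊕ ⊖ r′) ∎
      where
      a = κ ⊕ μ ⊕ ν ⊕ ⊖ (fromQ Q.3ℚ ⊗ μ)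
      e = fromQ Q.3ℚ ⊗ (κ ⊕ μ ⊕ ν) ⊕ ⊖ μ ⊕ ⊖ fromQ Q.4ℚ
      d = a ⊗ a ⊕ fromQ Q.8ℚ ⊗ μ ⊗ κ

    char-root : ∀ {r r′} → (∀ z → char z ≋ (z ⊕ ⊖ r) ⊗ (z ⊕ ⊖ r′)) → char r ≋ 0#
    char-root {r} factors = R.trans (factors r)
      (R.trans (R.*-congʳ (R.-‿inverseʳ r)) (R.zeroˡ _))

    difference-0⇒≋ : ∀ {a b} → a ⊕ ⊖ b ≋ 0# → a ≋ b
    difference-0⇒≋ {a} {b} a-b≋0 = begin
      a              ≈⟨ solve 2 (λ a b → a := (a :- b) :+ b) R.refl a b ⟩
      a ⊕ ⊖ b ⊕ b    ≈⟨ R.+-congʳ a-b≋0 ⟩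
      0# ⊕ b         ≈⟨ R.+-identityˡ b ⟩
      b              ∎

-- Moduli and the theorem

module ℂR = CommutativeRing ℂ-commutativeRing

modulus² : ∀ z → modulus z * modulus z ≈ re z * re z + im z * im z
modulus² z = ≈-trans {modulus z * modulus z} {√ w * √ w} {w} (pointwise λ _ → refl)
  (√-square w (λ i → 0≤+ (0≤square (seq (re z) i)) (0≤square (seq (im z) i))))
  where
  w : ℝ
  w = re z * re z + im z * im z

modulus²-ι : ∀ {z c} → z ≈ᶜ ι c → modulus z * modulus z ≈ c * c
modulus²-ι {z} {c} (re≈c ,ᶜ im≈0) =
  ≈-trans {modulus z * modulus z} {re z * re z + im z * im z} {c * c} (modulus² z)
    (≈-trans {re z * re z + im z * im z} {c * c + 0ℝ * 0ℝ} {c * c}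
      (+-cong {re z * re z} {c * c} {im z * im z} {0ℝ * 0ℝ}
        (*-cong {re z} {c} {re z} {c} re≈c re≈c) (*-cong {im z} {0ℝ} {im z} {0ℝ} im≈0 im≈0))
      (pointwise λ i → im-real* 0≡ (seq c i ℚ.* seq c i) (ℤ→ℚ (+ 0))))

-- The bound is on squares, so that the sign of `c` need not be determined; this suits `ρ′`, which
-- is a difference.
modulus-≤ : ∀ {z c} r → z ≈ᶜ ι c → (∀ i → 0ℚ ℚ.≤ seq r i) →
  (∀ i → seq c i ℚ.* seq c i ℚ.≤ seq r i ℚ.* seq r i) → modulus z ≤ r
modulus-≤ {z} {c} r z≈c 0≤r c²≤r² = square-≤-square⇒≤ {modulus z} {r} 0≤r
  (≤-trans {modulus z * modulus z} {c * c} {r * r}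
    (≈⇒≤ {modulus z * modulus z} {c * c} (modulus²-ι {z} {c} z≈c))
    (≤-pointwise {c * c} {r * r} c²≤r²))

modulus-ι : ∀ r → (∀ i → 0ℚ ℚ.≤ seq r i) → modulus (ι r) ≈ r
modulus-ι r 0≤r = ≤-antisym {modulus (ι r)} {r}
  (modulus-≤ {ι r} {r} r (≈ᶜ-refl {ι r}) 0≤r (λ i → ℚ.≤-refl))
  (square-≤-square⇒≤ {r} {modulus (ι r)}
    (λ i → approx√-nonNeg (seq (r * r + 0ℝ * 0ℝ) i) i)
    (≈⇒≤ {r * r} {modulus (ι r) * modulus (ι r)}
      (≈-sym {modulus (ι r) * modulus (ι r)} {r * r} (modulus²-ι {ι r} {r} (≈ᶜ-refl {ι r})))))

fromℚᶜ-≉0 : ∀ {q} → 0ℚ ℚ.< q → ¬ (fromℚᶜ q ≈ᶜ 0ᶜ)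
fromℚᶜ-≉0 {q} 0<q qᶜ≈0 =
  let (q≈0 ,ᶜ _) = subst (_≈ᶜ 0ᶜ) (fromℚᶜ≡ι q) qᶜ≈0
      (N , h)    = ≈0⇒Null {fromℚ q} q≈0 (½ ℚ.* q) (0<½* 0<q) in
  ℚ.<-irrefl refl (ℚ.<-≤-trans (½*< 0<q)
    (subst (ℚ._≤ ½ ℚ.* q) (ℚ.0≤p⇒∣p∣≡p (ℚ.<⇒≤ 0<q)) (h N ℕ.≤-refl)))

module _ {e r} (0≤e : 0ℚ ℚ.≤ e) (0≤r : 0ℚ ℚ.≤ r) where

  0≤½[e+r] : 0ℚ ℚ.≤ ½ ℚ.* (e ℚ.+ r)
  0≤½[e+r] = 0≤* (ℚ.nonNegative⁻¹ ½) (0≤+ 0≤e 0≤r)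

  conjugate²≤ : (½ ℚ.* (e ℚ.- r)) ℚ.* (½ ℚ.* (e ℚ.- r)) ℚ.≤ (½ ℚ.* (e ℚ.+ r)) ℚ.* (½ ℚ.* (e ℚ.+ r))
  conjugate²≤ = ≤-by-gap (e ℚ.* r) (0≤* 0≤e 0≤r)
    (solve 2 (λ e r →
      (con ½ :* (e :- r)) :* (con ½ :* (e :- r)) :+ e :* r :=
      (con ½ :* (e :+ r)) :* (con ½ :* (e :+ r))) refl e r)
    where open ℚS

  -- The gap `g` witnesses `2 c ≤ e`, so `c` is at most `e / 2` and adding `r / 2` only helps.
  square-≤-root² : ∀ {c} g → 0ℚ ℚ.≤ c → 0ℚ ℚ.≤ g → c ℚ.+ c ℚ.+ g ≡ e →
    c ℚ.* c ℚ.≤ (½ ℚ.* (e ℚ.+ r)) ℚ.* (½ ℚ.* (e ℚ.+ r))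
  square-≤-root² {c} g 0≤c 0≤g refl = *-mono 0≤c 0≤c c≤ c≤
    where
    open ℚS
    c≤ : c ℚ.≤ ½ ℚ.* (c ℚ.+ c ℚ.+ g ℚ.+ r)
    c≤ = ≤-by-gap (½ ℚ.* (g ℚ.+ r)) (0≤* (ℚ.nonNegative⁻¹ ½) (0≤+ 0≤g 0≤r))
      (solve 3 (λ c g r → c :+ con ½ :* (g :+ r) := con ½ :* (c :+ c :+ g :+ r)) refl c g r)

ι-cong : ∀ {x y} → x ≈ y → ι x ≈ᶜ ι y
ι-cong x≈y = x≈y ,ᶜ ≈-refl {0ℝ}

vertex-in-S : ∀ k m l → 1 ℕ.≤ k → ∃[ i ] part {k ℕ.+ m ℕ.+ l} k m i ≡ S
vertex-in-S (suc k) m l _ = zero , refl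

-- The candidate eigenvalues compared with the largest root

module Spectrum (k m l : ℕ) (1≤k : 1 ℕ.≤ k) (1≤l : 1 ℕ.≤ l) where

  open Rationals k m l using (κ; μ; ν; trace; trace≡; discriminant; discriminant≡; shift; 2ℚ; 3ℚ; 4ℚ; 8ℚ)

  0≤ℕ : ∀ a → 0ℚ ℚ.≤ ℤ→ℚ (+ a)
  0≤ℕ a = ℚ.nonNegative⁻¹ (ℤ→ℚ (+ a))

  ℕ≤ : ∀ {a b} → a ℕ.≤ b → ℤ→ℚ (+ a) ℚ.≤ ℤ→ℚ (+ b)
  ℕ≤ a≤b = *≤* (ℤ.*-monoʳ-≤-nonNeg (+ 1) (+≤+ a≤b))

  0<ν : 0ℚ ℚ.< ν
  0<ν = ℚ.<-≤-trans (ℚ.positive⁻¹ (ℤ→ℚ (+ 1))) (ℕ≤ 1≤l)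

  -- `k` and `l` contribute at least 1 each, which pays for the 2 that is subtracted.
  0≤shiftV₂ : 0ℚ ℚ.≤ shift V₂
  0≤shiftV₂ = 0≤q-p (ℚ.+-mono-≤ (ℕ≤ 1≤k) (ℕ≤ 1≤l))

  0≤shiftS : 0ℚ ℚ.≤ shift S
  0≤shiftS = ℚ.≤-trans 0≤shiftV₂ (≤-by-gap μ (0≤ℕ m)
    (solve 3 (λ κ μ ν → κ :+ ν :- con 2ℚ :+ μ := κ :+ μ :+ ν :- con 2ℚ) refl κ μ ν))
    where open ℚS

  -- `κ + ν` here, and `κ + ν + 2 μ` in `trace-shiftV₂`, are the gaps that `square-≤-root²` asks
  -- for.
  trace-shiftS : shift S ℚ.+ shift S ℚ.+ (κ ℚ.+ ν) ≡ ℤ→ℚ trace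
  trace-shiftS = trans
    (solve 3 (λ κ μ ν → let s = κ :+ μ :+ ν :- con 2ℚ in
      s :+ s :+ (κ :+ ν) := con 3ℚ :* (κ :+ μ :+ ν) :- μ :- con 4ℚ) refl κ μ ν)
    (sym trace≡)
    where open ℚS

  trace-shiftV₂ : shift V₂ ℚ.+ shift V₂ ℚ.+ (κ ℚ.+ ν ℚ.+ (μ ℚ.+ μ)) ≡ ℤ→ℚ trace
  trace-shiftV₂ = trans
    (solve 3 (λ κ μ ν → let s = κ :+ ν :- con 2ℚ in
      s :+ s :+ (κ :+ ν :+ (μ :+ μ)) := con 3ℚ :* (κ :+ μ :+ ν) :- μ :- con 4ℚ) refl κ μ ν)
    (sym trace≡)
    where open ℚS

  0≤κ+ν : 0ℚ ℚ.≤ κ ℚ.+ ν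
  0≤κ+ν = 0≤+ (0≤ℕ k) (0≤ℕ l)

  0≤trace : 0ℚ ℚ.≤ ℤ→ℚ trace
  0≤trace = subst (0ℚ ℚ.≤_) trace-shiftS (0≤+ (0≤+ 0≤shiftS 0≤shiftS) 0≤κ+ν)

  0≤discriminant : 0ℚ ℚ.≤ ℤ→ℚ discriminant
  0≤discriminant = subst (0ℚ ℚ.≤_) (sym discriminant≡)
    (0≤+ (0≤square ((κ ℚ.+ μ ℚ.+ ν) ℚ.- 3ℚ ℚ.* μ)) (0≤* (0≤* (0≤ℕ 8) (0≤ℕ m)) (0≤ℕ k)))

  module Roots (s ρ ρ′ : ℝ) (s² : s * s ≈ fromℚ (ℤ→ℚ discriminant)) (0≤s : ∀ i → 0ℚ ℚ.≤ seq s i)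
    (ρ≡ : ∀ i → seq ρ i ≡ ½ ℚ.* (ℤ→ℚ trace ℚ.+ seq s i))
    (ρ′≡ : ∀ i → seq ρ′ i ≡ ½ ℚ.* (ℤ→ℚ trace ℚ.- seq s i)) where

    open SignlessLaplacian ℂ-commutativeRing ℚ→ℂ using (module Parts)
    module P = Parts k m l

    0≤ρ : ∀ i → 0ℚ ℚ.≤ seq ρ i
    0≤ρ i = subst (0ℚ ℚ.≤_) (sym (ρ≡ i)) (0≤½[e+r] 0≤trace (0≤s i))

    ≤ρ² : ∀ {q} i → q ℚ.≤ (½ ℚ.* (ℤ→ℚ trace ℚ.+ seq s i)) ℚ.* (½ ℚ.* (ℤ→ℚ trace ℚ.+ seq s i)) →
          q ℚ.≤ seq ρ i ℚ.* seq ρ i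
    ≤ρ² {q} i = subst (λ a → q ℚ.≤ a ℚ.* a) (sym (ρ≡ i))

    factors : ∀ z → P.char z ≈ᶜ (z ⊞ ⊟ ι ρ) ⊠ (z ⊞ ⊟ ι ρ′)
    factors = P.char-factors {ι s} {ι ρ} {ι ρ′}
      (ℂR.trans (ℂR.sym (ι-⊠ {s * s} s s (λ _ → refl)))
        (subst (ι (s * s) ≈ᶜ_) (sym (fromℚᶜ≡ι (ℤ→ℚ discriminant)))
          (ι-cong {s * s} {fromℚ (ℤ→ℚ discriminant)} s²)))
      (subst₂ (λ h t → ι ρ ≈ᶜ h ⊠ (t ⊞ ι s)) (sym (fromℚᶜ≡ι ½)) (sym (fromℚᶜ≡ι (ℤ→ℚ trace)))
        (ℂR.trans (ι-⊠ {ρ} ½ᵣ (e + s) ρ≡) (ℂR.*-congˡ (ι-⊞ {e + s} e s (λ _ → refl)))))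
      (subst₂ (λ h t → ι ρ′ ≈ᶜ h ⊠ (t ⊞ ⊟ ι s)) (sym (fromℚᶜ≡ι ½)) (sym (fromℚᶜ≡ι (ℤ→ℚ trace)))
        (ℂR.trans (ι-⊠ {ρ′} ½ᵣ (e - s) ρ′≡) (ℂR.*-congˡ
          (ℂR.trans (ι-⊞ {e - s} e (- s) (λ _ → refl)) (ℂR.+-congˡ (ι-⊟ { - s} s (λ _ → refl)))))))
      where
      ½ᵣ e : ℝ
      ½ᵣ = fromℚ ½
      e  = fromℚ (ℤ→ℚ trace)

    v : Vector ℂ (k ℕ.+ m ℕ.+ l)
    v j = P.profile (ι ρ) (part k m j)

    ρ-eigenvalue : IsEigenvalue (signlessLaplacian (K⃗ (k ℕ.+ m ℕ.+ l) k m)) (ι ρ)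
    ρ-eigenvalue = isEigenvalue (K⃗ (k ℕ.+ m ℕ.+ l) k m) (ι ρ) v v≉0
      (P.profile-eigenvector {ι ρ} (P.char-root {ι ρ} {ι ρ′} factors))
      where
      v≉0 : ¬ (∀ i → v i ≈ᶜ 0ᶜ)
      v≉0 v≈0 = fromℚᶜ-≉0 0<ν (subst (λ p → P.profile (ι ρ) p ≈ᶜ 0ᶜ)
        (proj₂ (vertex-in-S k m l 1≤k)) (v≈0 (proj₁ (vertex-in-S k m l 1≤k))))

    eigenvalue-bound : ∀ z → IsEigenvalue (signlessLaplacian (K⃗ (k ℕ.+ m ℕ.+ l) k m)) z → modulus z ≤ ρ
    eigenvalue-bound z eigenvalue = ≤-stable {modulus z} {ρ} λ z≰ρ → u≉0 (u≈0 z≰ρ)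
      where
      u   = proj₁ (eigenvector (K⃗ (k ℕ.+ m ℕ.+ l) k m) z eigenvalue)
      u≉0 = proj₁ (proj₂ (eigenvector (K⃗ (k ℕ.+ m ℕ.+ l) k m) z eigenvalue))
      open P.Eigenvector {z} u (proj₂ (proj₂ (eigenvector (K⃗ (k ℕ.+ m ℕ.+ l) k m) z eigenvalue)))
      module _ (z≰ρ : ¬ (modulus z ≤ ρ)) where
        ≉ι : ∀ c → (∀ i → seq c i ℚ.* seq c i ℚ.≤ seq ρ i ℚ.* seq ρ i) → ¬ (z ⊞ ⊟ ι c ≈ᶜ 0ᶜ)
        ≉ι c c²≤ρ² z-c≈0 = z≰ρ (modulus-≤ {z} {c} ρ (P.difference-0⇒≋ z-c≈0) 0≤ρ c²≤ρ²)
        ≉shift : ∀ p → (∀ i → shift p ℚ.* shift p ℚ.≤ seq ρ i ℚ.* seq ρ i) →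
                 ¬ (z ⊞ ⊟ P.shift p ≈ᶜ 0ᶜ)
        ≉shift p p²≤ρ² z-p≈0 = ≉ι (fromℚ (shift p)) p²≤ρ²
          (ℂR.trans (ℂR.+-congˡ (ℂR.-‿cong (ℂR.sym
            (subst (P.shift p ≈ᶜ_) (fromℚᶜ≡ι (shift p)) (P.shift≋ p))))) z-p≈0)
        char≉0 : ¬ (P.char z ≈ᶜ 0ᶜ)
        char≉0 char≈0 = ≉ι ρ′
          (λ i → ≤ρ² i (subst (λ a → a ℚ.* a ℚ.≤ _) (sym (ρ′≡ i)) (conjugate²≤ 0≤trace (0≤s i))))
          -- `z - ρ` is already excluded from being zero, so `factors` leaves `z - ρ′` as the factor
          -- that vanishes.
          (⊠-cancelˡ-0 (≉ι ρ λ i → ℚ.≤-refl) (ℂR.trans (ℂR.sym (factors z)) char≈0))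
        u≈0 : ∀ i → u i ≈ᶜ 0ᶜ
        u≈0 = spectrum ⊠-cancelˡ-0 (fromℚᶜ-≉0 0<ν)
          (≉shift S λ i → ≤ρ² i
            (square-≤-root² 0≤trace (0≤s i) (κ ℚ.+ ν) 0≤shiftS 0≤κ+ν trace-shiftS))
          (≉shift V₂ λ i → ≤ρ² i
            (square-≤-root² 0≤trace (0≤s i) (κ ℚ.+ ν ℚ.+ (μ ℚ.+ μ)) 0≤shiftV₂
              (0≤+ 0≤κ+ν (0≤+ (0≤ℕ m) (0≤ℕ m))) trace-shiftV₂))
          char≉0

    spectralRadius : IsSpectralRadius (signlessLaplacian (K⃗ (k ℕ.+ m ℕ.+ l) k m)) ρ
    spectralRadius =
      (ι ρ , ρ-eigenvalue , un≈ (modulus-ι ρ 0≤ρ)) , eigenvalue-bound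

√-nonNeg : ∀ x i → 0ℚ ℚ.≤ seq (√ x) i
√-nonNeg x i = approx√-nonNeg (seq x i) i

√-fromℤ² : ∀ d → 0ℚ ℚ.≤ ℤ→ℚ d → √ (fromℤ d) * √ (fromℤ d) ≈ fromℚ (ℤ→ℚ d)
√-fromℤ² d 0≤d = √-square (fromℤ d) (λ _ → 0≤d)

seq-root : ∀ e s i → seq (fromℚ ½ * (fromℤ e + s)) i ≡ ½ ℚ.* (ℤ→ℚ e ℚ.+ seq s i)
seq-root e s i = refl

seq-conjugate : ∀ e s i → seq (fromℚ ½ * (fromℤ e - s)) i ≡ ½ ℚ.* (ℤ→ℚ e ℚ.- seq s i)
seq-conjugate e s i = refl

-- n, e, d and s are kept apart from the expressions for them, which would otherwise
-- be unfolded into rational sequences and Cauchy proofs when types are compared.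
spectralRadius-K⃗ : ∀ n k m l → let module Q = Rationals k m l in
  n ≡ k ℕ.+ m ℕ.+ l → 1 ℕ.≤ k → 1 ℕ.≤ l →
  ∀ e d s → e ≡ Q.trace → d ≡ Q.discriminant →
  (∀ i → 0ℚ ℚ.≤ seq s i) → (0ℚ ℚ.≤ ℤ→ℚ d → s * s ≈ fromℚ (ℤ→ℚ d)) →
  IsSpectralRadius (signlessLaplacian (K⃗ n k m)) (fromℚ ½ * (fromℤ e + s))
spectralRadius-K⃗ _ k m l refl 1≤k 1≤l e d s e≡ d≡ 0≤s s² =
  spectralRadius s (fromℚ ½ * (fromℤ e + s)) (fromℚ ½ * (fromℤ e - s))
    (≈-trans {s * s} {fromℚ (ℤ→ℚ d)} {fromℚ (ℤ→ℚ (Rationals.discriminant k m l))}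
      (s² (subst (λ d → 0ℚ ℚ.≤ ℤ→ℚ d) (sym d≡) 0≤discriminant)) (pointwise λ _ → cong ℤ→ℚ d≡))
    0≤s
    (λ i → trans (seq-root e s i) (cong (λ e → ½ ℚ.* (ℤ→ℚ e ℚ.+ seq s i)) e≡))
    (λ i → trans (seq-conjugate e s i) (cong (λ e → ½ ℚ.* (ℤ→ℚ e ℚ.- seq s i)) e≡))
  where
  open Spectrum k m l 1≤k 1≤l using (0≤discriminant; module Roots)
  open Roots using (spectralRadius)

-- The witness is the size of `V₂` less 1, so that its positivity can be read off `suc`. The
-- truncated subtractions are exact: `k ≤ n ∸ 2` gives `k ≤ n`, and `1 ≤ m ≤ n ∸ k ∸ 1` gives
-- `1 ≤ n ∸ k`.
part-sizes : ∀ n k m → k ℕ.≤ n ∸ 2 → 1 ℕ.≤ m → m ℕ.≤ n ∸ k ∸ 1 →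
  ∃[ l-1 ] n ≡ k ℕ.+ m ℕ.+ suc l-1
part-sizes n k m k≤n-2 1≤m m≤n-k-1 = n ∸ k ∸ 1 ∸ m , (begin
  n                                     ≡⟨ ℕ.m+[n∸m]≡n (ℕ.≤-trans k≤n-2 (ℕ.m∸n≤m n 2)) ⟨
  k ℕ.+ (n ∸ k)                         ≡⟨ cong (k ℕ.+_) (ℕ.m+[n∸m]≡n 1≤n-k) ⟨
  k ℕ.+ suc (n ∸ k ∸ 1)                 ≡⟨ cong (λ a → k ℕ.+ suc a) (ℕ.m+[n∸m]≡n m≤n-k-1) ⟨
  k ℕ.+ suc (m ℕ.+ (n ∸ k ∸ 1 ∸ m))     ≡⟨ cong (k ℕ.+_) (ℕ.+-suc m _) ⟨
  k ℕ.+ (m ℕ.+ suc (n ∸ k ∸ 1 ∸ m))     ≡⟨ ℕ.+-assoc k m _ ⟨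
  k ℕ.+ m ℕ.+ suc (n ∸ k ∸ 1 ∸ m)       ∎)
  where
  open ≡-Reasoning
  1≤n-k : 1 ℕ.≤ n ∸ k
  1≤n-k = ℕ.≤-trans 1≤m (ℕ.≤-trans m≤n-k-1 (ℕ.m∸n≤m (n ∸ k) 1))

theorem6p3 : (n k m : ℕ) →
    1 ℕ.≤ n →
    1 ℕ.≤ k → k ℕ.≤ n ∸ 2 →
    1 ℕ.≤ m → m ℕ.≤ n ∸ k ∸ 1 →
    IsSpectralRadius (signlessLaplacian (K⃗ n k m))
    (fromℚ ½ *
    (fromℤ ((+ 3) ℤ.* (+ n) ℤ.- (+ m) ℤ.- (+ 4))
    + √ (fromℤ (((+ n) ℤ.- (+ 3) ℤ.* (+ m)) ℤ.^ 2
    ℤ.+ (+ 8) ℤ.* (+ m) ℤ.* (+ k)))))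
theorem6p3 n k m 1≤n 1≤k k≤n-2 1≤m m≤n-k-1 =
  spectralRadius-K⃗ n k m (suc l-1) n≡ 1≤k (s≤s z≤n)
    ((+ 3) ℤ.* (+ n) ℤ.- (+ m) ℤ.- (+ 4))
    (((+ n) ℤ.- (+ 3) ℤ.* (+ m)) ℤ.^ 2 ℤ.+ (+ 8) ℤ.* (+ m) ℤ.* (+ k))
    (√ (fromℤ (((+ n) ℤ.- (+ 3) ℤ.* (+ m)) ℤ.^ 2 ℤ.+ (+ 8) ℤ.* (+ m) ℤ.* (+ k))))
    (cong (λ n → (+ 3) ℤ.* (+ n) ℤ.- (+ m) ℤ.- (+ 4)) n≡)
    (cong (λ n → ((+ n) ℤ.- (+ 3) ℤ.* (+ m)) ℤ.^ 2 ℤ.+ (+ 8) ℤ.* (+ m) ℤ.* (+ k)) n≡)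
    (√-nonNeg (fromℤ (((+ n) ℤ.- (+ 3) ℤ.* (+ m)) ℤ.^ 2 ℤ.+ (+ 8) ℤ.* (+ m) ℤ.* (+ k))))
    (√-fromℤ² (((+ n) ℤ.- (+ 3) ℤ.* (+ m)) ℤ.^ 2 ℤ.+ (+ 8) ℤ.* (+ m) ℤ.* (+ k)))
  where
  l-1 = proj₁ (part-sizes n k m k≤n-2 1≤m m≤n-k-1)
  n≡  = proj₂ (part-sizes n k m k≤n-2 1≤m m≤n-k-1)
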